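{- Let $L,H$ be functional causal models in a Markov category $\mathcal C$ with endogenous variables $V_L,V_H$, let $(\pi,\tau)$ be a variable alignment from $V_L$ to $V_H$, and let $Q\subseteq\mathrm{CF}^{c}(V_H)$ be a collection of concrete counterfactual queries (with types $V_H$). Then $L,H$ satisfy $Q$-$\tau$ consistency if and only if the data determines an upward abstraction $(\pi,\tau,\omega)\colon(\mathrm{CF}^{c}(V_L),L)\to(Q,H)$ via $$\omega\big([\pi(Y_1)|_{x_1},\dots,\pi(Y_m)|_{x_m}]\big):=[Y_1|_{\tau\circ x_1},\dots,Y_m|_{\tau\circ x_m}]$$ for all queries $[Y_1|_{\tau\circ x_1},\dots,Y_m|_{\tau\circ x_m}]$ in $Q$ (with $X_j,Y_j\subseteq V_H$ and $x_j$ a sharp state of $\pi(X_j)$).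
   Context: **Categories.** A Markov category is a symmetric monoidal category with terminal unit $I$ in which each object has a commutative comonoid structure (copy, discard) compatible with $\otimes$. Morphisms are called channels; $f$ is deterministic if $\mathrm{copy}\circ f=(f\otimes f)\circ\mathrm{copy}$; a sharp state of $A$ is a deterministic morphism $I\to A$. **Functional causal models (FCMs).** An FCM $M$ in $\mathcal C$ consists of a finite acyclic directed graph on variables $V\cup U$ with $V=\{X_1,\dots,X_n\}$ (endogenous) and $U=\{U_1,\dots,U_n\}$ (exogenous), where each $U_i$ has no parents and each $X_i$ has parents $\mathrm{Pa}'(X_i)\cup\{U_i\}$ with $\mathrm{Pa}'(X_i)\subseteq V$; an object of $\mathcal C$ for each variable; a state $\lambda_i\colon I\to U_i$ for each $i$; and a deterministic channel $f_i\colon\mathrm{Pa}'(X_i)\otimes U_i\to X_i$ for each $i$. It has no inputs, and outputs $V$. A set of variables is also used for the list of its elements (lists of distinct variables considered up to permutation) and for the tensor of the corresponding objects. Let $\lambda=\bigotimes_i\lambda_i\colon I\to U$. Let $F$ be the deterministic part of $M$: the causal model with inputs $U$ and mechanisms $f_i$. For $X,Y\subseteq V$ let $F_{\mathrm{Do}(X)}^{Y}\colon U\otimes X\to Y$ be the channel obtained by deleting the mechanisms $f_i$ of the variables in $X$, making $X$ into inputs, wiring the remaining mechanisms together with copy maps, and outputting (copies of) the variables in $Y$, discarding everything else. **Concrete counterfactual queries.** The signature $\mathrm{CF}^{c}(V)$ has types $V$ and, for all subsets $X_j,Y_j\subseteq V$ and sharp states $x_j$ of $X_j$ ($j=1,\dots,m$),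 a query $[Y_1|_{x_1},\dots,Y_m|_{x_m}]$ with no inputs and outputs $Y_1,\dots,Y_m$, modelled by an FCM $M$ as the state $$[\![\,[Y_1|_{x_1},\dots,Y_m|_{x_m}]\,]\!]_M=\big(F_{\mathrm{Do}(X_1)}^{Y_1}\otimes\dots\otimes F_{\mathrm{Do}(X_m)}^{Y_m}\big)\circ\big((\mathrm{copy}^{(m)}_U\circ\lambda)\otimes x_1\otimes\dots\otimes x_m\big),$$ with $\mathrm{copy}^{(m)}_U\colon U\to U^{\otimes m}$ the $m$-fold copy, the $j$-th copy of $U$ together with $x_j$ being fed into the $j$-th factor. **Variable alignment** $(\pi,\tau)$ from $V_L$ to $V_H$: pairwise disjoint subsets $\pi(X)\subseteq V_L$, $X\in V_H$ (with $\pi(S)=\bigcup_{X\in S}\pi(X)$), and epic deterministic channels $\tau_X\colon\pi(X)\to X$ (with $\tau_S=\bigotimes_{X\in S}\tau_X$, often written $\tau$; all tensor products of the $\tau_X$ are also required to be epic). **$Q$-$\tau$ consistency:** for all $X_j,Y_j\subseteq V_H$ and sharp states $x_j$ of $\pi(X_j)$ such that $[Y_1|_{\tau\circ x_1},\dots,Y_m|_{\tau\circ x_m}]\in Q$, $$(\tau_{Y_1}\otimes\dots\otimes\tau_{Y_m})\circ[\![\,[\pi(Y_1)|_{x_1},\dots,\pi(Y_m)|_{x_m}]\,]\!]_L=[\![\,[Y_1|_{\tau\circ x_1},\dots,Y_m|_{\tau\circ x_m}]\,]\!]_H.$$ **Upward abstraction** $(\pi,\tau,\omega)\colon(Q_L,L)\to(Q_H,H)$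 between query signatures with models: for each type $X$ of $Q_H$, a list $\pi(X)$ of types of $Q_L$ and an epic deterministic channel $\tau_X\colon[\![\pi(X)]\!]_L\to[\![X]\!]_H$ (extended to lists by concatenation and tensor product, all such products being required to be epic); and a partial surjective map $\omega$ from queries of $Q_L$ to queries of $Q_H$ such that whenever $\omega(q_L)=q_H\colon A\to B$ is defined, $q_L$ has type $\pi(A)\to\pi(B)$ and $\tau_B\circ[\![q_L]\!]_L=[\![q_H]\!]_H\circ\tau_A$.
   Formalization: For "consistency implies abstraction" it is additionally assumed that every π(X) is nonempty and that every query in Q has the form [Y_1|τ∘x_1,…,Y_m|τ∘x_m] with x_j a sharp state of π(X_j); otherwise ω may fail to be single-valued or surjective. -}

module Defs where

open import Level using (Level; _⊔_) renaming (suc to lsuc)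
open import Data.Fin using (Fin)
import Data.Fin.Properties as Fin
open import Data.Fin.Induction using (spo-wellFounded)
open import Data.List using (List; []; _∷_; _++_; map; concatMap; allFin)
open import Data.List.Membership.Propositional using (_∈_; _∉_)
open import Data.List.Membership.Propositional.Properties using (∈-allFin)
import Data.List.Membership.DecPropositional as DecMembership
open import Data.List.Relation.Binary.Disjoint.Propositional using (Disjoint)
open import Data.List.Relation.Binary.Permutation.Propositional using (_↭_; ↭-refl; ↭-sym)
open import Data.List.Relation.Binary.Permutation.Propositional.Properties using (∈-resp-↭; ∈-resp-[σ∘σ⁻¹])
open import Data.List.Relation.Binary.Pointwise as Pointwise using (Pointwise)
open import Data.List.Relation.Binary.Subset.Propositional using (_⊆_)
import Data.List.Relation.Unary.All as All
import Data.List.Relation.Unary.All.Properties as All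
import Data.List.Relation.Unary.AllPairs as AllPairs
import Data.List.Relation.Unary.AllPairs.Properties as AllPairs
open import Data.List.Relation.Unary.Any using (here; there)
open import Data.List.Relation.Unary.Unique.Propositional using (Unique)
import Data.List.Relation.Unary.Unique.Propositional.Properties as Unique
open import Data.Nat using (ℕ)
open import Data.Product using (Σ; _×_; _,_; proj₁; ∃-syntax)
open import Induction.WellFounded using (WellFounded) renaming (module All to WF)
open import Relation.Binary using (Setoid; Rel; REL; IsEquivalence; IsStrictPartialOrder)
open import Relation.Binary.Construct.Closure.Transitive using (TransClosure)
import Relation.Binary.Construct.Closure.Transitive as Plus
import Relation.Binary.Construct.On as On
import Relation.Binary.Reasoning.Setoid as SetoidReasoning
open import Relation.Binary.PropositionalEquality
  using (_≡_; _≢_; refl; isEquivalence; resp₂; subst₂)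
open import Relation.Nullary using (¬_; yes; no)
open import Relation.Unary using (Pred)

record Category (o ℓ e : Level) : Set (lsuc (o ⊔ ℓ ⊔ e)) where
  infixr 9 _∘_
  infix  4 _⇒_ _≈_
  field
    Obj       : Set o
    _⇒_       : Obj → Obj → Set ℓ
    _≈_       : ∀ {A B} → Rel (A ⇒ B) e
    id        : ∀ {A} → A ⇒ A
    _∘_       : ∀ {A B C} → B ⇒ C → A ⇒ B → A ⇒ C
    assoc     : ∀ {A B C D} {f : A ⇒ B} {g : B ⇒ C} {h : C ⇒ D} →
                (h ∘ g) ∘ f ≈ h ∘ (g ∘ f)
    identityˡ : ∀ {A B} {f : A ⇒ B} → id ∘ f ≈ f
    identityʳ : ∀ {A B} {f : A ⇒ B} → f ∘ id ≈ f
    equiv     : ∀ {A B} → IsEquivalence (_≈_ {A} {B})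
    ∘-resp-≈  : ∀ {A B C} {f h : B ⇒ C} {g i : A ⇒ B} →
                f ≈ h → g ≈ i → f ∘ g ≈ h ∘ i

  Epic : ∀ {A B} → A ⇒ B → Set (o ⊔ ℓ ⊔ e)
  Epic {B = B} f = ∀ {C} (g h : B ⇒ C) → g ∘ f ≈ h ∘ f → g ≈ h

record SymmetricMonoidalCategory (o ℓ e : Level) : Set (lsuc (o ⊔ ℓ ⊔ e)) where
  field
    category : Category o ℓ e
  open Category category public

  infixr 10 _⊗₀_ _⊗₁_
  field
    unit     : Obj
    _⊗₀_     : Obj → Obj → Obj
    _⊗₁_     : ∀ {A B C D} → A ⇒ B → C ⇒ D → A ⊗₀ C ⇒ B ⊗₀ D
    ⊗-id     : ∀ {A B} → id {A} ⊗₁ id {B} ≈ id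
    ⊗-∘      : ∀ {A B C A′ B′ C′} {f : A ⇒ B} {g : B ⇒ C} {f′ : A′ ⇒ B′} {g′ : B′ ⇒ C′} →
               (g ∘ f) ⊗₁ (g′ ∘ f′) ≈ (g ⊗₁ g′) ∘ (f ⊗₁ f′)
    ⊗-resp-≈ : ∀ {A B C D} {f h : A ⇒ B} {g i : C ⇒ D} →
               f ≈ h → g ≈ i → f ⊗₁ g ≈ h ⊗₁ i

    λ⇒   : ∀ {A} → unit ⊗₀ A ⇒ A
    λ⇐   : ∀ {A} → A ⇒ unit ⊗₀ A
    λ-isoˡ : ∀ {A} → λ⇐ ∘ λ⇒ {A} ≈ id
    λ-isoʳ : ∀ {A} → λ⇒ ∘ λ⇐ {A} ≈ id
    λ-natural : ∀ {A B} {f : A ⇒ B} → λ⇒ ∘ (id ⊗₁ f) ≈ f ∘ λ⇒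

    ρ⇒   : ∀ {A} → A ⊗₀ unit ⇒ A
    ρ⇐   : ∀ {A} → A ⇒ A ⊗₀ unit
    ρ-isoˡ : ∀ {A} → ρ⇐ ∘ ρ⇒ {A} ≈ id
    ρ-isoʳ : ∀ {A} → ρ⇒ ∘ ρ⇐ {A} ≈ id
    ρ-natural : ∀ {A B} {f : A ⇒ B} → ρ⇒ ∘ (f ⊗₁ id) ≈ f ∘ ρ⇒

    α⇒   : ∀ {A B C} → (A ⊗₀ B) ⊗₀ C ⇒ A ⊗₀ (B ⊗₀ C)
    α⇐   : ∀ {A B C} → A ⊗₀ (B ⊗₀ C) ⇒ (A ⊗₀ B) ⊗₀ C
    α-isoˡ : ∀ {A B C} → α⇐ ∘ α⇒ {A} {B} {C} ≈ id
    α-isoʳ : ∀ {A B C} → α⇒ ∘ α⇐ {A} {B} {C} ≈ id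
    α-natural : ∀ {A B C A′ B′ C′} {f : A ⇒ A′} {g : B ⇒ B′} {h : C ⇒ C′} →
                α⇒ ∘ ((f ⊗₁ g) ⊗₁ h) ≈ (f ⊗₁ (g ⊗₁ h)) ∘ α⇒

    σ    : ∀ {A B} → A ⊗₀ B ⇒ B ⊗₀ A
    σ-σ  : ∀ {A B} → σ ∘ σ {A} {B} ≈ id
    σ-natural : ∀ {A B A′ B′} {f : A ⇒ A′} {g : B ⇒ B′} →
                σ ∘ (f ⊗₁ g) ≈ (g ⊗₁ f) ∘ σ

    triangle : ∀ {A B} → (id {A} ⊗₁ λ⇒ {B}) ∘ α⇒ ≈ ρ⇒ ⊗₁ id
    pentagon : ∀ {A B C D} →
               (id {A} ⊗₁ α⇒ {B} {C} {D}) ∘ α⇒ ∘ (α⇒ ⊗₁ id) ≈ α⇒ ∘ α⇒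
    hexagon  : ∀ {A B C} →
               (id {B} ⊗₁ σ {A} {C}) ∘ α⇒ ∘ (σ ⊗₁ id) ≈ α⇒ ∘ σ ∘ α⇒

  swapFront : ∀ {A B C} → A ⊗₀ (B ⊗₀ C) ⇒ B ⊗₀ (A ⊗₀ C)
  swapFront = α⇒ ∘ (σ ⊗₁ id) ∘ α⇐

  interchange : ∀ {A B C D} → (A ⊗₀ B) ⊗₀ (C ⊗₀ D) ⇒ (A ⊗₀ C) ⊗₀ (B ⊗₀ D)
  interchange = α⇐ ∘ (id ⊗₁ swapFront) ∘ α⇒

record MarkovCategory (o ℓ e : Level) : Set (lsuc (o ⊔ ℓ ⊔ e)) where
  field
    symmetricMonoidal : SymmetricMonoidalCategory o ℓ e
  open SymmetricMonoidalCategory symmetricMonoidal public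

  field
    copy : ∀ {A} → A ⇒ A ⊗₀ A
    del  : ∀ {A} → A ⇒ unit
    del-unique   : ∀ {A} (f : A ⇒ unit) → f ≈ del
    copy-assoc   : ∀ {A} → α⇒ ∘ (copy ⊗₁ id) ∘ copy {A} ≈ (id ⊗₁ copy) ∘ copy
    copy-unitˡ   : ∀ {A} → λ⇒ ∘ (del ⊗₁ id) ∘ copy {A} ≈ id
    copy-unitʳ   : ∀ {A} → ρ⇒ ∘ (id ⊗₁ del) ∘ copy {A} ≈ id
    copy-comm    : ∀ {A} → σ ∘ copy {A} ≈ copy
    copy-⊗       : ∀ {A B} → copy {A ⊗₀ B} ≈ interchange ∘ (copy ⊗₁ copy)
    copy-unit    : copy {unit} ≈ λ⇐

  Deterministic : ∀ {A B} → A ⇒ B → Set e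
  Deterministic f = copy ∘ f ≈ (f ⊗₁ f) ∘ copy

  record SharpState (A : Obj) : Set (ℓ ⊔ e) where
    constructor sharp
    field
      state         : unit ⇒ A
      deterministic : Deterministic state

  infix 11 ⟨_,_⟩
  ⟨_,_⟩ : ∀ {A B C} → A ⇒ B → A ⇒ C → A ⇒ B ⊗₀ C
  ⟨ f , g ⟩ = (f ⊗₁ g) ∘ copy

  exl : ∀ {A B} → A ⊗₀ B ⇒ A
  exl = ρ⇒ ∘ (id ⊗₁ del)

  exr : ∀ {A B} → A ⊗₀ B ⇒ B
  exr = λ⇒ ∘ (del ⊗₁ id)

module MarkovProperties {o ℓ e} (C : MarkovCategory o ℓ e) where
  open MarkovCategory C
  private module ≈ {A B} = IsEquivalence (equiv {A} {B})
  open ≈ public using () renaming (refl to ≈-refl; sym to ≈-sym; trans to ≈-trans)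

  hom : ∀ {A B : Obj} → Setoid ℓ e
  hom {A} {B} = record { isEquivalence = equiv {A} {B} }

  private module ⇒-Reasoning {A B} = SetoidReasoning (hom {A} {B})
  open ⇒-Reasoning

  infixr 4 _⟩∘⟨_ _⟩⊗⟨_ refl⟩∘⟨_

  _⟩∘⟨_ : ∀ {A B C} {f h : B ⇒ C} {g i : A ⇒ B} → f ≈ h → g ≈ i → f ∘ g ≈ h ∘ i
  _⟩∘⟨_ = ∘-resp-≈

  _⟩⊗⟨_ : ∀ {A B C D} {f h : A ⇒ B} {g i : C ⇒ D} → f ≈ h → g ≈ i → f ⊗₁ g ≈ h ⊗₁ i
  _⟩⊗⟨_ = ⊗-resp-≈

  refl⟩∘⟨_ : ∀ {A B C} {f : B ⇒ C} {g i : A ⇒ B} → g ≈ i → f ∘ g ≈ f ∘ i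
  refl⟩∘⟨_ = ∘-resp-≈ ≈-refl

  pullˡ : ∀ {A B C D} {a : C ⇒ D} {b : B ⇒ C} {c : B ⇒ D} {f : A ⇒ B} → a ∘ b ≈ c → a ∘ b ∘ f ≈ c ∘ f
  pullˡ p = ≈-trans (≈-sym assoc) (p ⟩∘⟨ ≈-refl)

  pushˡ : ∀ {A B C D} {a : C ⇒ D} {b : B ⇒ C} {c : B ⇒ D} {f : A ⇒ B} → c ≈ a ∘ b → c ∘ f ≈ a ∘ b ∘ f
  pushˡ p = ≈-sym (pullˡ (≈-sym p))

  extend : ∀ {A B C C′ D} {a : C ⇒ D} {b : B ⇒ C} {c : C′ ⇒ D} {d : B ⇒ C′} {f : A ⇒ B} →
    a ∘ b ≈ c ∘ d → a ∘ b ∘ f ≈ c ∘ d ∘ f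
  extend p = ≈-trans (pullˡ p) assoc

  cancelˡ : ∀ {A B C} {a : B ⇒ C} {b : C ⇒ B} {f : A ⇒ C} → a ∘ b ≈ id → a ∘ b ∘ f ≈ f
  cancelˡ p = ≈-trans (pullˡ p) identityˡ

  id⊗∘ : ∀ {A B C D} {g : B ⇒ C} {f : A ⇒ B} → (id {D} ⊗₁ g) ∘ (id ⊗₁ f) ≈ id ⊗₁ (g ∘ f)
  id⊗∘ = ≈-trans (≈-sym ⊗-∘) (identityˡ ⟩⊗⟨ ≈-refl)

  ∘⊗id : ∀ {A B C D} {g : B ⇒ C} {f : A ⇒ B} → (g ⊗₁ id {D}) ∘ (f ⊗₁ id) ≈ (g ∘ f) ⊗₁ id
  ∘⊗id = ≈-trans (≈-sym ⊗-∘) (≈-refl ⟩⊗⟨ identityˡ)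

  α⇐-natural : ∀ {A B C A′ B′ C′} {f : A ⇒ A′} {g : B ⇒ B′} {h : C ⇒ C′} →
                α⇐ ∘ (f ⊗₁ (g ⊗₁ h)) ≈ ((f ⊗₁ g) ⊗₁ h) ∘ α⇐
  α⇐-natural {f = f} {g} {h} = begin
    α⇐ ∘ (f ⊗₁ (g ⊗₁ h)) ≈⟨ refl⟩∘⟨ ≈-trans (≈-sym identityʳ) (refl⟩∘⟨ ≈-sym α-isoʳ) ⟩
    α⇐ ∘ (f ⊗₁ (g ⊗₁ h)) ∘ α⇒ ∘ α⇐ ≈⟨ refl⟩∘⟨ extend (≈-sym α-natural) ⟩
    α⇐ ∘ α⇒ ∘ ((f ⊗₁ g) ⊗₁ h) ∘ α⇐ ≈⟨ cancelˡ α-isoˡ ⟩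
    ((f ⊗₁ g) ⊗₁ h) ∘ α⇐ ∎

  monic : ∀ {A B C} {a : B ⇒ C} {b : C ⇒ B} {f g : A ⇒ B} → b ∘ a ≈ id → a ∘ f ≈ a ∘ g → f ≈ g
  monic p q = ≈-trans (≈-sym (cancelˡ p)) (≈-trans (refl⟩∘⟨ q) (cancelˡ p))

  epic : ∀ {A B C} {a : A ⇒ B} {b : B ⇒ A} {f g : B ⇒ C} → a ∘ b ≈ id → f ∘ a ≈ g ∘ a → f ≈ g
  epic {f = f} {g} p q = ≈-trans (≈-sym identityʳ) (≈-trans (refl⟩∘⟨ ≈-sym p) (≈-trans (extend q) (≈-trans (refl⟩∘⟨ p) identityʳ)))

  swapFront-α : ∀ {A B C} → swapFront ∘ α⇒ {A} {B} {C} ≈ α⇒ ∘ (σ ⊗₁ id)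
  swapFront-α = ≈-trans assoc (refl⟩∘⟨ ≈-trans assoc (≈-trans (refl⟩∘⟨ α-isoˡ) identityʳ))

  swapFront-natural : ∀ {A B A′ B′ C C′} {f : A ⇒ A′} {g : B ⇒ B′} {h : C ⇒ C′} →
     swapFront ∘ (f ⊗₁ (g ⊗₁ h)) ≈ (g ⊗₁ (f ⊗₁ h)) ∘ swapFront
  swapFront-natural {f = f} {g} {h} = begin
    (α⇒ ∘ (σ ⊗₁ id) ∘ α⇐) ∘ (f ⊗₁ (g ⊗₁ h)) ≈⟨ ≈-trans assoc (refl⟩∘⟨ assoc) ⟩
    α⇒ ∘ (σ ⊗₁ id) ∘ α⇐ ∘ (f ⊗₁ (g ⊗₁ h)) ≈⟨ refl⟩∘⟨ refl⟩∘⟨ α⇐-natural ⟩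
    α⇒ ∘ (σ ⊗₁ id) ∘ ((f ⊗₁ g) ⊗₁ h) ∘ α⇐ ≈⟨ refl⟩∘⟨ extend (≈-trans (≈-sym ⊗-∘) (≈-trans (σ-natural ⟩⊗⟨ ≈-trans identityˡ (≈-sym identityʳ)) ⊗-∘)) ⟩
    α⇒ ∘ ((g ⊗₁ f) ⊗₁ h) ∘ (σ ⊗₁ id) ∘ α⇐ ≈⟨ extend α-natural ⟩
    (g ⊗₁ (f ⊗₁ h)) ∘ α⇒ ∘ (σ ⊗₁ id) ∘ α⇐ ∎

  α-swapFront : ∀ {A B C W} → (id ⊗₁ α⇒ {A} {C} {W}) ∘ α⇒ {B} ∘ (swapFront ⊗₁ id) ≈
        swapFront ∘ (id ⊗₁ α⇒) ∘ α⇒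
  α-swapFront = epic {a = α⇒ ⊗₁ id} {b = α⇐ ⊗₁ id} (≈-trans ∘⊗id (≈-trans (α-isoʳ ⟩⊗⟨ ≈-refl) ⊗-id)) (begin
    ((id ⊗₁ α⇒) ∘ α⇒ ∘ (swapFront ⊗₁ id)) ∘ (α⇒ ⊗₁ id) ≈⟨ ≈-trans assoc (refl⟩∘⟨ assoc) ⟩
    (id ⊗₁ α⇒) ∘ α⇒ ∘ (swapFront ⊗₁ id) ∘ (α⇒ ⊗₁ id) ≈⟨ refl⟩∘⟨ refl⟩∘⟨ ≈-trans ∘⊗id (≈-trans (swapFront-α ⟩⊗⟨ ≈-refl) (≈-sym ∘⊗id)) ⟩
    (id ⊗₁ α⇒) ∘ α⇒ ∘ (α⇒ ⊗₁ id) ∘ ((σ ⊗₁ id) ⊗₁ id) ≈⟨ ≈-trans (refl⟩∘⟨ ≈-sym assoc) (extend pentagon) ⟩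
    α⇒ ∘ α⇒ ∘ ((σ ⊗₁ id) ⊗₁ id) ≈⟨ refl⟩∘⟨ α-natural ⟩
    α⇒ ∘ (σ ⊗₁ (id ⊗₁ id)) ∘ α⇒ ≈⟨ refl⟩∘⟨ (≈-refl ⟩⊗⟨ ⊗-id) ⟩∘⟨ ≈-refl ⟩
    α⇒ ∘ (σ ⊗₁ id) ∘ α⇒ ≈⟨ extend (≈-sym swapFront-α) ⟩
    swapFront ∘ α⇒ ∘ α⇒ ≈⟨ refl⟩∘⟨ pentagon ⟨
    swapFront ∘ (id ⊗₁ α⇒) ∘ α⇒ ∘ (α⇒ ⊗₁ id) ≈⟨ ≈-trans assoc (refl⟩∘⟨ assoc) ⟨
    (swapFront ∘ (id ⊗₁ α⇒) ∘ α⇒) ∘ (α⇒ ⊗₁ id) ∎)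

  id⊗-square : ∀ {A B C D E} {f : A ⇒ B} {g : B ⇒ C} {h : A ⇒ E} {k : E ⇒ C} → g ∘ f ≈ k ∘ h →
     (id {D} ⊗₁ g) ∘ (id ⊗₁ f) ≈ (id ⊗₁ k) ∘ (id ⊗₁ h)
  id⊗-square p = ≈-trans id⊗∘ (≈-trans (≈-refl ⟩⊗⟨ p) (≈-sym id⊗∘))

  swapFront-involutive : ∀ {A B C} → swapFront ∘ swapFront {A} {B} {C} ≈ id
  swapFront-involutive = begin
    swapFront ∘ α⇒ ∘ (σ ⊗₁ id) ∘ α⇐ ≈⟨ extend swapFront-α ⟩
    α⇒ ∘ (σ ⊗₁ id) ∘ (σ ⊗₁ id) ∘ α⇐ ≈⟨ refl⟩∘⟨ cancelˡ (≈-trans ∘⊗id (≈-trans (σ-σ ⟩⊗⟨ ≈-refl) ⊗-id)) ⟩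
    α⇒ ∘ α⇐ ≈⟨ α-isoʳ ⟩
    id ∎

  σ⊗-inv : ∀ {A B C} → (σ {A} {B} ⊗₁ id {C}) ∘ (σ ⊗₁ id) ≈ id
  σ⊗-inv = ≈-trans ∘⊗id (≈-trans (σ-σ ⟩⊗⟨ ≈-refl) ⊗-id)

  ⊗σ-inv : ∀ {A B C} → (id {C} ⊗₁ σ {A} {B}) ∘ (id ⊗₁ σ) ≈ id
  ⊗σ-inv = ≈-trans id⊗∘ (≈-trans (≈-refl ⟩⊗⟨ σ-σ) ⊗-id)

  σ-⊗ˡ : ∀ {A B C} → σ {A ⊗₀ B} {C} ≈ swapFront ∘ (id ⊗₁ σ) ∘ α⇒
  σ-⊗ˡ = monic {a = σ} σ-σ (monic {a = α⇒} α-isoˡ (begin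
    α⇒ ∘ σ ∘ σ ≈⟨ ≈-trans (refl⟩∘⟨ σ-σ) identityʳ ⟩
    α⇒ ≈⟨ cancelˡ ⊗σ-inv ⟨
    (id ⊗₁ σ) ∘ (id ⊗₁ σ) ∘ α⇒ ≈⟨ refl⟩∘⟨ cancelˡ α-isoʳ ⟨
    (id ⊗₁ σ) ∘ α⇒ ∘ α⇐ ∘ (id ⊗₁ σ) ∘ α⇒ ≈⟨ refl⟩∘⟨ refl⟩∘⟨ cancelˡ σ⊗-inv ⟨
    (id ⊗₁ σ) ∘ α⇒ ∘ (σ ⊗₁ id) ∘ (σ ⊗₁ id) ∘ α⇐ ∘ (id ⊗₁ σ) ∘ α⇒ ≈⟨ ≈-trans (refl⟩∘⟨ ≈-sym assoc) (pullˡ hexagon) ⟩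
    (α⇒ ∘ σ ∘ α⇒) ∘ (σ ⊗₁ id) ∘ α⇐ ∘ (id ⊗₁ σ) ∘ α⇒ ≈⟨ ≈-trans assoc (refl⟩∘⟨ assoc) ⟩
    α⇒ ∘ σ ∘ α⇒ ∘ (σ ⊗₁ id) ∘ α⇐ ∘ (id ⊗₁ σ) ∘ α⇒ ≈⟨ refl⟩∘⟨ refl⟩∘⟨ ≈-trans assoc (refl⟩∘⟨ assoc) ⟨
    α⇒ ∘ σ ∘ swapFront ∘ (id ⊗₁ σ) ∘ α⇒ ∎))

  swapFront-⊗ˡ : ∀ {A B C W} → (id {C} ⊗₁ α⇒ {A} {B} {W}) ∘ swapFront ≈
         swapFront ∘ (id ⊗₁ swapFront) ∘ α⇒
  swapFront-⊗ˡ = epic α-isoʳ (begin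
    ((id ⊗₁ α⇒) ∘ swapFront) ∘ α⇒ ≈⟨ ≈-trans assoc (refl⟩∘⟨ swapFront-α) ⟩
    (id ⊗₁ α⇒) ∘ α⇒ ∘ (σ ⊗₁ id) ≈⟨ refl⟩∘⟨ refl⟩∘⟨ ≈-trans (σ-⊗ˡ ⟩⊗⟨ ≈-refl) (≈-sym ∘⊗id) ⟩
    (id ⊗₁ α⇒) ∘ α⇒ ∘ (swapFront ⊗₁ id) ∘ (((id ⊗₁ σ) ∘ α⇒) ⊗₁ id) ≈⟨ ≈-trans (refl⟩∘⟨ ≈-sym assoc) (pullˡ α-swapFront) ⟩
    (swapFront ∘ (id ⊗₁ α⇒) ∘ α⇒) ∘ (((id ⊗₁ σ) ∘ α⇒) ⊗₁ id) ≈⟨ ≈-trans assoc (refl⟩∘⟨ assoc) ⟩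
    swapFront ∘ (id ⊗₁ α⇒) ∘ α⇒ ∘ (((id ⊗₁ σ) ∘ α⇒) ⊗₁ id) ≈⟨ refl⟩∘⟨ refl⟩∘⟨ refl⟩∘⟨ ∘⊗id ⟨
    swapFront ∘ (id ⊗₁ α⇒) ∘ α⇒ ∘ ((id ⊗₁ σ) ⊗₁ id) ∘ (α⇒ ⊗₁ id) ≈⟨ refl⟩∘⟨ refl⟩∘⟨ extend α-natural ⟩
    swapFront ∘ (id ⊗₁ α⇒) ∘ (id ⊗₁ (σ ⊗₁ id)) ∘ α⇒ ∘ (α⇒ ⊗₁ id) ≈⟨ refl⟩∘⟨ extend (id⊗-square (≈-sym swapFront-α)) ⟩
    swapFront ∘ (id ⊗₁ swapFront) ∘ (id ⊗₁ α⇒) ∘ α⇒ ∘ (α⇒ ⊗₁ id) ≈⟨ refl⟩∘⟨ refl⟩∘⟨ pentagon ⟩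
    swapFront ∘ (id ⊗₁ swapFront) ∘ α⇒ ∘ α⇒ ≈⟨ ≈-trans assoc (refl⟩∘⟨ assoc) ⟨
    (swapFront ∘ (id ⊗₁ swapFront) ∘ α⇒) ∘ α⇒ ∎)

  swapFront-⊗ʳ : ∀ {A B C Z} → α⇒ ∘ swapFront {A} {B ⊗₀ C} {Z} ≈
        (id ⊗₁ swapFront) ∘ swapFront ∘ (id ⊗₁ α⇒)
  swapFront-⊗ʳ = epic swapFront-involutive (monic (id⊗ swapFront-involutive) (monic swapFront-involutive (begin
      swapFront ∘ (id ⊗₁ swapFront) ∘ (α⇒ ∘ swapFront) ∘ swapFront ≈⟨ refl⟩∘⟨ refl⟩∘⟨ ≈-trans assoc (≈-trans (refl⟩∘⟨ swapFront-involutive) identityʳ) ⟩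
      swapFront ∘ (id ⊗₁ swapFront) ∘ α⇒ ≈⟨ swapFront-⊗ˡ ⟨
      (id ⊗₁ α⇒) ∘ swapFront ≈⟨ cancelˡ swapFront-involutive ⟨
      swapFront ∘ swapFront ∘ (id ⊗₁ α⇒) ∘ swapFront ≈⟨ refl⟩∘⟨ cancelˡ (id⊗ swapFront-involutive) ⟨
      swapFront ∘ (id ⊗₁ swapFront) ∘ (id ⊗₁ swapFront) ∘ swapFront ∘ (id ⊗₁ α⇒) ∘ swapFront ≈⟨ refl⟩∘⟨ refl⟩∘⟨ ≈-trans assoc (refl⟩∘⟨ assoc) ⟨
      swapFront ∘ (id ⊗₁ swapFront) ∘ ((id ⊗₁ swapFront) ∘ swapFront ∘ (id ⊗₁ α⇒)) ∘ swapFront ∎)))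
    where
    id⊗ : ∀ {A B C} {f : A ⇒ B} {g : B ⇒ A} → g ∘ f ≈ id → (id {C} ⊗₁ g) ∘ (id ⊗₁ f) ≈ id
    id⊗ p = ≈-trans id⊗∘ (≈-trans (≈-refl ⟩⊗⟨ p) ⊗-id)

  α∘interchange : ∀ {A B C D} → α⇒ ∘ interchange {A} {B} {C} {D} ≈ (id ⊗₁ swapFront) ∘ α⇒
  α∘interchange = cancelˡ α-isoʳ

  swapFront-interchange : ∀ {A B B′ C C′} →
      (id {B} ⊗₁ ((id {C} ⊗₁ α⇒ {A} {B′} {C′}) ∘ swapFront)) ∘ α⇒ ∘ (swapFront ⊗₁ id) ≈
      α⇒ ∘ swapFront ∘ (id ⊗₁ interchange) ∘ α⇒
  swapFront-interchange = begin
    (id ⊗₁ ((id ⊗₁ α⇒) ∘ swapFront)) ∘ α⇒ ∘ (swapFront ⊗₁ id) ≈⟨ (≈-refl ⟩⊗⟨ swapFront-⊗ˡ) ⟩∘⟨ ≈-refl ⟩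
    (id ⊗₁ (swapFront ∘ (id ⊗₁ swapFront) ∘ α⇒)) ∘ α⇒ ∘ (swapFront ⊗₁ id)
       ≈⟨ ≈-trans (≈-sym id⊗∘) (refl⟩∘⟨ ≈-sym id⊗∘) ⟩∘⟨ ≈-refl ⟩
    ((id ⊗₁ swapFront) ∘ (id ⊗₁ (id ⊗₁ swapFront)) ∘ (id ⊗₁ α⇒)) ∘ α⇒ ∘ (swapFront ⊗₁ id)
       ≈⟨ ≈-trans assoc (refl⟩∘⟨ assoc) ⟩
    (id ⊗₁ swapFront) ∘ (id ⊗₁ (id ⊗₁ swapFront)) ∘ (id ⊗₁ α⇒) ∘ α⇒ ∘ (swapFront ⊗₁ id)
       ≈⟨ refl⟩∘⟨ refl⟩∘⟨ α-swapFront ⟩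
    (id ⊗₁ swapFront) ∘ (id ⊗₁ (id ⊗₁ swapFront)) ∘ swapFront ∘ (id ⊗₁ α⇒) ∘ α⇒
       ≈⟨ refl⟩∘⟨ extend (≈-sym swapFront-natural) ⟩
    (id ⊗₁ swapFront) ∘ swapFront ∘ (id ⊗₁ (id ⊗₁ swapFront)) ∘ (id ⊗₁ α⇒) ∘ α⇒
       ≈⟨ refl⟩∘⟨ refl⟩∘⟨ extend (id⊗-square (≈-sym α∘interchange)) ⟩
    (id ⊗₁ swapFront) ∘ swapFront ∘ (id ⊗₁ α⇒) ∘ (id ⊗₁ interchange) ∘ α⇒
       ≈⟨ ≈-trans (refl⟩∘⟨ ≈-sym assoc) (pullˡ (≈-sym swapFront-⊗ʳ)) ⟩
    (α⇒ ∘ swapFront) ∘ (id ⊗₁ interchange) ∘ α⇒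
       ≈⟨ assoc ⟩
    α⇒ ∘ swapFront ∘ (id ⊗₁ interchange) ∘ α⇒ ∎

  interchange-assoc : ∀ {A A′ B B′ C C′} →
      (α⇒ {A} {B} {C} ⊗₁ α⇒ {A′} {B′} {C′}) ∘ interchange ∘ (interchange ⊗₁ id) ≈
      interchange ∘ (id ⊗₁ interchange) ∘ α⇒
  interchange-assoc = monic α-isoˡ (monic (≈-trans id⊗∘ (≈-trans (≈-refl ⟩⊗⟨ α-isoˡ) ⊗-id)) (begin
    (id ⊗₁ α⇒) ∘ α⇒ ∘ (α⇒ ⊗₁ α⇒) ∘ interchange ∘ (interchange ⊗₁ id)
      ≈⟨ refl⟩∘⟨ refl⟩∘⟨ ≈-trans (≈-trans (≈-sym identityʳ) ≈-refl ⟩⊗⟨ ≈-sym identityˡ) ⊗-∘ ⟩∘⟨ ≈-refl ⟩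
    (id ⊗₁ α⇒) ∘ α⇒ ∘ ((α⇒ ⊗₁ id) ∘ (id ⊗₁ α⇒)) ∘ interchange ∘ (interchange ⊗₁ id)
      ≈⟨ refl⟩∘⟨ refl⟩∘⟨ assoc ⟩
    (id ⊗₁ α⇒) ∘ α⇒ ∘ (α⇒ ⊗₁ id) ∘ (id ⊗₁ α⇒) ∘ interchange ∘ (interchange ⊗₁ id)
      ≈⟨ ≈-trans (refl⟩∘⟨ ≈-sym assoc) (extend pentagon) ⟩
    α⇒ ∘ α⇒ ∘ (id ⊗₁ α⇒) ∘ interchange ∘ (interchange ⊗₁ id)
      ≈⟨ refl⟩∘⟨ refl⟩∘⟨ (≈-sym ⊗-id ⟩⊗⟨ ≈-refl) ⟩∘⟨ ≈-refl ⟩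
    α⇒ ∘ α⇒ ∘ ((id ⊗₁ id) ⊗₁ α⇒) ∘ interchange ∘ (interchange ⊗₁ id)
      ≈⟨ refl⟩∘⟨ extend α-natural ⟩
    α⇒ ∘ (id ⊗₁ (id ⊗₁ α⇒)) ∘ α⇒ ∘ interchange ∘ (interchange ⊗₁ id)
      ≈⟨ refl⟩∘⟨ refl⟩∘⟨ extend α∘interchange ⟩
    α⇒ ∘ (id ⊗₁ (id ⊗₁ α⇒)) ∘ (id ⊗₁ swapFront) ∘ α⇒ ∘ (interchange ⊗₁ id)
      ≈⟨ refl⟩∘⟨ pullˡ id⊗∘ ⟩
    α⇒ ∘ (id ⊗₁ ((id ⊗₁ α⇒) ∘ swapFront)) ∘ α⇒ ∘ (interchange ⊗₁ id)
      ≈⟨ refl⟩∘⟨ (≈-sym ⊗-id ⟩⊗⟨ ≈-refl) ⟩∘⟨ ≈-refl ⟩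
    α⇒ ∘ ((id ⊗₁ id) ⊗₁ ((id ⊗₁ α⇒) ∘ swapFront)) ∘ α⇒ ∘ (interchange ⊗₁ id)
      ≈⟨ extend α-natural ⟩
    (id ⊗₁ (id ⊗₁ ((id ⊗₁ α⇒) ∘ swapFront))) ∘ α⇒ ∘ α⇒ ∘ (interchange ⊗₁ id)
      ≈⟨ refl⟩∘⟨ ≈-trans (extend (≈-sym pentagon)) (refl⟩∘⟨ assoc) ⟩
    (id ⊗₁ (id ⊗₁ ((id ⊗₁ α⇒) ∘ swapFront))) ∘ (id ⊗₁ α⇒) ∘ α⇒ ∘ (α⇒ ⊗₁ id) ∘ (interchange ⊗₁ id)
      ≈⟨ refl⟩∘⟨ refl⟩∘⟨ refl⟩∘⟨ ≈-trans ∘⊗id (≈-trans (α∘interchange ⟩⊗⟨ ≈-refl) (≈-sym ∘⊗id)) ⟩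
    (id ⊗₁ (id ⊗₁ ((id ⊗₁ α⇒) ∘ swapFront))) ∘ (id ⊗₁ α⇒) ∘ α⇒ ∘ ((id ⊗₁ swapFront) ⊗₁ id) ∘ (α⇒ ⊗₁ id)
      ≈⟨ refl⟩∘⟨ refl⟩∘⟨ extend α-natural ⟩
    (id ⊗₁ (id ⊗₁ ((id ⊗₁ α⇒) ∘ swapFront))) ∘ (id ⊗₁ α⇒) ∘ (id ⊗₁ (swapFront ⊗₁ id)) ∘ α⇒ ∘ (α⇒ ⊗₁ id)
      ≈⟨ ≈-trans (refl⟩∘⟨ pullˡ id⊗∘) (pullˡ id⊗∘) ⟩
    (id ⊗₁ ((id ⊗₁ ((id ⊗₁ α⇒) ∘ swapFront)) ∘ α⇒ ∘ (swapFront ⊗₁ id))) ∘ α⇒ ∘ (α⇒ ⊗₁ id)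
      ≈⟨ (≈-refl ⟩⊗⟨ swapFront-interchange) ⟩∘⟨ ≈-refl ⟩
    (id ⊗₁ (α⇒ ∘ swapFront ∘ (id ⊗₁ interchange) ∘ α⇒)) ∘ α⇒ ∘ (α⇒ ⊗₁ id)
      ≈⟨ ≈-trans (≈-sym id⊗∘) (refl⟩∘⟨ ≈-trans (≈-sym id⊗∘) (refl⟩∘⟨ ≈-sym id⊗∘)) ⟩∘⟨ ≈-refl ⟩
    ((id ⊗₁ α⇒) ∘ (id ⊗₁ swapFront) ∘ (id ⊗₁ (id ⊗₁ interchange)) ∘ (id ⊗₁ α⇒)) ∘ α⇒ ∘ (α⇒ ⊗₁ id)
      ≈⟨ ≈-trans assoc (refl⟩∘⟨ ≈-trans assoc (refl⟩∘⟨ ≈-trans assoc (refl⟩∘⟨ pentagon))) ⟩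
    (id ⊗₁ α⇒) ∘ (id ⊗₁ swapFront) ∘ (id ⊗₁ (id ⊗₁ interchange)) ∘ α⇒ ∘ α⇒
      ≈⟨ refl⟩∘⟨ refl⟩∘⟨ extend (≈-trans (≈-sym α-natural) (refl⟩∘⟨ (⊗-id ⟩⊗⟨ ≈-refl))) ⟩
    (id ⊗₁ α⇒) ∘ (id ⊗₁ swapFront) ∘ α⇒ ∘ (id ⊗₁ interchange) ∘ α⇒
      ≈⟨ refl⟩∘⟨ extend (≈-sym α∘interchange) ⟩
    (id ⊗₁ α⇒) ∘ α⇒ ∘ interchange ∘ (id ⊗₁ interchange) ∘ α⇒ ∎))

  interchange-natural : ∀ {A B C D A′ B′ C′ D′} {f : A ⇒ A′} {g : B ⇒ B′} {h : C ⇒ C′} {k : D ⇒ D′} →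
      interchange ∘ ((f ⊗₁ g) ⊗₁ (h ⊗₁ k)) ≈ ((f ⊗₁ h) ⊗₁ (g ⊗₁ k)) ∘ interchange
  interchange-natural {f = f} {g} {h} {k} = begin
    (α⇐ ∘ (id ⊗₁ swapFront) ∘ α⇒) ∘ ((f ⊗₁ g) ⊗₁ (h ⊗₁ k)) ≈⟨ ≈-trans assoc (refl⟩∘⟨ assoc) ⟩
    α⇐ ∘ (id ⊗₁ swapFront) ∘ α⇒ ∘ ((f ⊗₁ g) ⊗₁ (h ⊗₁ k)) ≈⟨ refl⟩∘⟨ refl⟩∘⟨ α-natural ⟩
    α⇐ ∘ (id ⊗₁ swapFront) ∘ (f ⊗₁ (g ⊗₁ (h ⊗₁ k))) ∘ α⇒ ≈⟨ refl⟩∘⟨ extend (≈-trans (≈-sym ⊗-∘) (≈-trans (≈-trans identityˡ (≈-sym identityʳ) ⟩⊗⟨ swapFront-natural) ⊗-∘)) ⟩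
    α⇐ ∘ (f ⊗₁ (h ⊗₁ (g ⊗₁ k))) ∘ (id ⊗₁ swapFront) ∘ α⇒ ≈⟨ extend α⇐-natural ⟩
    ((f ⊗₁ h) ⊗₁ (g ⊗₁ k)) ∘ α⇐ ∘ (id ⊗₁ swapFront) ∘ α⇒ ∎

  λ-α : ∀ {A B} → λ⇒ ∘ α⇒ {unit} {A} {B} ≈ λ⇒ ⊗₁ id
  λ-α {A} {B} = unit⊗-faithful (epic α-isoʳ (epic {a = α⇒ ⊗₁ id} {b = α⇐ ⊗₁ id} (≈-trans ∘⊗id (≈-trans (α-isoʳ ⟩⊗⟨ ≈-refl) ⊗-id)) (begin
    ((id ⊗₁ (λ⇒ ∘ α⇒)) ∘ α⇒) ∘ (α⇒ ⊗₁ id) ≈⟨ assoc ⟩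
    (id ⊗₁ (λ⇒ ∘ α⇒)) ∘ α⇒ ∘ (α⇒ ⊗₁ id) ≈⟨ pushˡ (≈-sym id⊗∘) ⟩
    (id ⊗₁ λ⇒) ∘ (id ⊗₁ α⇒) ∘ α⇒ ∘ (α⇒ ⊗₁ id) ≈⟨ refl⟩∘⟨ pentagon ⟩
    (id ⊗₁ λ⇒) ∘ α⇒ ∘ α⇒ ≈⟨ pullˡ triangle ⟩
    (ρ⇒ ⊗₁ id) ∘ α⇒ ≈⟨ ≈-trans (refl⟩∘⟨ ≈-refl) ((≈-refl ⟩⊗⟨ ≈-sym ⊗-id) ⟩∘⟨ ≈-refl) ⟩
    (ρ⇒ ⊗₁ (id ⊗₁ id)) ∘ α⇒ ≈⟨ α-natural ⟨
    α⇒ ∘ ((ρ⇒ ⊗₁ id) ⊗₁ id) ≈⟨ refl⟩∘⟨ ≈-trans (≈-sym triangle ⟩⊗⟨ ≈-refl) (≈-sym ∘⊗id) ⟩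
    α⇒ ∘ ((id ⊗₁ λ⇒) ⊗₁ id) ∘ (α⇒ ⊗₁ id) ≈⟨ ≈-trans (extend α-natural) (≈-sym assoc) ⟩
    ((id ⊗₁ (λ⇒ ⊗₁ id)) ∘ α⇒) ∘ (α⇒ ⊗₁ id) ∎)))
    where
    unit⊗-faithful : ∀ {A B} {f g : A ⇒ B} → id {unit} ⊗₁ f ≈ id ⊗₁ g → f ≈ g
    unit⊗-faithful p = epic λ-isoʳ (≈-trans (≈-sym λ-natural) (≈-trans (refl⟩∘⟨ p) λ-natural))

  into-unit : ∀ {A} {f g : A ⇒ unit} → f ≈ g
  into-unit {f = f} {g} = ≈-trans (del-unique f) (≈-sym (del-unique g))

  λ∘σ : ∀ {A} → λ⇒ ∘ σ {A} ≈ ρ⇒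
  λ∘σ {A} = ⊗unit-faithful (monic {a = σ} σ-σ (begin
    σ ∘ ((λ⇒ ∘ σ) ⊗₁ id) ≈⟨ refl⟩∘⟨ ∘⊗id ⟨
    σ ∘ (λ⇒ ⊗₁ id) ∘ (σ ⊗₁ id) ≈⟨ refl⟩∘⟨ λ-α ⟩∘⟨ ≈-refl ⟨
    σ ∘ (λ⇒ ∘ α⇒) ∘ (σ ⊗₁ id) ≈⟨ refl⟩∘⟨ assoc ⟩
    σ ∘ λ⇒ ∘ α⇒ ∘ (σ ⊗₁ id) ≈⟨ extend (≈-sym λ-natural) ⟩
    λ⇒ ∘ (id ⊗₁ σ) ∘ α⇒ ∘ (σ ⊗₁ id) ≈⟨ refl⟩∘⟨ hexagon ⟩
    λ⇒ ∘ α⇒ ∘ σ ∘ α⇒ ≈⟨ pullˡ λ-α ⟩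
    (λ⇒ ⊗₁ id) ∘ σ ∘ α⇒ ≈⟨ extend (≈-sym σ-natural) ⟩
    σ ∘ (id ⊗₁ λ⇒) ∘ α⇒ ≈⟨ refl⟩∘⟨ triangle ⟩
    σ ∘ (ρ⇒ ⊗₁ id) ∎))
    where
    ⊗unit-faithful : ∀ {A B} {f g : A ⇒ B} → f ⊗₁ id {unit} ≈ g ⊗₁ id → f ≈ g
    ⊗unit-faithful p = epic ρ-isoʳ (≈-trans (≈-sym ρ-natural) (≈-trans (refl⟩∘⟨ p) ρ-natural))

  ρ∘σ : ∀ {A} → ρ⇒ ∘ σ {unit} {A} ≈ λ⇒
  ρ∘σ = ≈-trans (≈-sym λ∘σ ⟩∘⟨ ≈-refl) (≈-trans assoc (≈-trans (refl⟩∘⟨ σ-σ) identityʳ))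

  λ⊗id∘α⇐ : ∀ {A B} → (λ⇒ ⊗₁ id) ∘ α⇐ {unit} {A} {B} ≈ λ⇒
  λ⊗id∘α⇐ = ≈-trans (≈-sym λ-α ⟩∘⟨ ≈-refl) (≈-trans assoc (≈-trans (refl⟩∘⟨ α-isoʳ) identityʳ))

  id⊗λ∘swapFront : ∀ {A B} → (id {A} ⊗₁ λ⇒ {B}) ∘ swapFront ≈ λ⇒
  id⊗λ∘swapFront = begin
    (id ⊗₁ λ⇒) ∘ α⇒ ∘ (σ ⊗₁ id) ∘ α⇐ ≈⟨ pullˡ triangle ⟩
    (ρ⇒ ⊗₁ id) ∘ (σ ⊗₁ id) ∘ α⇐ ≈⟨ pullˡ (≈-trans ∘⊗id (ρ∘σ ⟩⊗⟨ ≈-refl)) ⟩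
    (λ⇒ ⊗₁ id) ∘ α⇐ ≈⟨ λ⊗id∘α⇐ ⟩
    λ⇒ ∎

  interchange-unit : ∀ {A B} → (λ⇒ {A} ⊗₁ λ⇒ {B}) ∘ interchange ∘ (λ⇐ ⊗₁ id) ≈ λ⇒
  interchange-unit = begin
    (λ⇒ ⊗₁ λ⇒) ∘ interchange ∘ (λ⇐ ⊗₁ id) ≈⟨ (≈-trans (≈-sym identityˡ ⟩⊗⟨ ≈-sym identityʳ) ⊗-∘) ⟩∘⟨ ≈-refl ⟩
    ((id ⊗₁ λ⇒) ∘ (λ⇒ ⊗₁ id)) ∘ interchange ∘ (λ⇐ ⊗₁ id) ≈⟨ ≈-trans assoc (refl⟩∘⟨ refl⟩∘⟨ ≈-trans assoc (refl⟩∘⟨ assoc)) ⟩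
    (id ⊗₁ λ⇒) ∘ (λ⇒ ⊗₁ id) ∘ α⇐ ∘ (id ⊗₁ swapFront) ∘ α⇒ ∘ (λ⇐ ⊗₁ id) ≈⟨ refl⟩∘⟨ pullˡ λ⊗id∘α⇐ ⟩
    (id ⊗₁ λ⇒) ∘ λ⇒ ∘ (id ⊗₁ swapFront) ∘ α⇒ ∘ (λ⇐ ⊗₁ id) ≈⟨ extend (≈-sym λ-natural) ⟩
    λ⇒ ∘ (id ⊗₁ (id ⊗₁ λ⇒)) ∘ (id ⊗₁ swapFront) ∘ α⇒ ∘ (λ⇐ ⊗₁ id) ≈⟨ refl⟩∘⟨ pullˡ (≈-trans id⊗∘ (≈-refl ⟩⊗⟨ id⊗λ∘swapFront)) ⟩
    λ⇒ ∘ (id ⊗₁ λ⇒) ∘ α⇒ ∘ (λ⇐ ⊗₁ id) ≈⟨ refl⟩∘⟨ pullˡ triangle ⟩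
    λ⇒ ∘ (ρ⇒ ⊗₁ id) ∘ (λ⇐ ⊗₁ id) ≈⟨ refl⟩∘⟨ ≈-trans ∘⊗id (≈-trans (into-unit ⟩⊗⟨ ≈-refl) ⊗-id) ⟩
    λ⇒ ∘ id ≈⟨ identityʳ ⟩
    λ⇒ ∎

  id-deterministic : ∀ {A} → Deterministic (id {A})
  id-deterministic = ≈-trans identityʳ (≈-sym (≈-trans (⊗-id ⟩∘⟨ ≈-refl) identityˡ))

  ∘-deterministic : ∀ {A B C} {g : B ⇒ C} {f : A ⇒ B} → Deterministic g → Deterministic f → Deterministic (g ∘ f)
  ∘-deterministic {g = g} {f} p q = begin
    copy ∘ g ∘ f ≈⟨ extend p ⟩
    (g ⊗₁ g) ∘ copy ∘ f ≈⟨ refl⟩∘⟨ q ⟩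
    (g ⊗₁ g) ∘ (f ⊗₁ f) ∘ copy ≈⟨ pullˡ (≈-sym ⊗-∘) ⟩
    ((g ∘ f) ⊗₁ (g ∘ f)) ∘ copy ∎

  ⊗-deterministic : ∀ {A B C D} {f : A ⇒ B} {g : C ⇒ D} → Deterministic f → Deterministic g → Deterministic (f ⊗₁ g)
  ⊗-deterministic {f = f} {g} p q = begin
    copy ∘ (f ⊗₁ g) ≈⟨ ≈-trans (copy-⊗ ⟩∘⟨ ≈-refl) assoc ⟩
    interchange ∘ (copy ⊗₁ copy) ∘ (f ⊗₁ g) ≈⟨ refl⟩∘⟨ ≈-trans (≈-sym ⊗-∘) (≈-trans (p ⟩⊗⟨ q) ⊗-∘) ⟩
    interchange ∘ ((f ⊗₁ f) ⊗₁ (g ⊗₁ g)) ∘ (copy ⊗₁ copy) ≈⟨ extend interchange-natural ⟩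
    ((f ⊗₁ g) ⊗₁ (f ⊗₁ g)) ∘ interchange ∘ (copy ⊗₁ copy) ≈⟨ refl⟩∘⟨ copy-⊗ ⟨
    ((f ⊗₁ g) ⊗₁ (f ⊗₁ g)) ∘ copy ∎

  inverse-deterministic : ∀ {A B} {f : A ⇒ B} {g : B ⇒ A} → g ∘ f ≈ id → f ∘ g ≈ id → Deterministic f → Deterministic g
  inverse-deterministic {f = f} {g} p q d = monic {a = f ⊗₁ f} {b = g ⊗₁ g} (≈-trans (≈-sym ⊗-∘) (≈-trans (p ⟩⊗⟨ p) ⊗-id)) (begin
    (f ⊗₁ f) ∘ copy ∘ g ≈⟨ extend (≈-sym d) ⟩
    copy ∘ f ∘ g ≈⟨ ≈-trans (refl⟩∘⟨ q) identityʳ ⟩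
    copy ≈⟨ cancelˡ (≈-trans (≈-sym ⊗-∘) (≈-trans (q ⟩⊗⟨ q) ⊗-id)) ⟨
    (f ⊗₁ f) ∘ (g ⊗₁ g) ∘ copy ∎)

  α-deterministic : ∀ {A B C} → Deterministic (α⇒ {A} {B} {C})
  α-deterministic = begin
    copy ∘ α⇒ ≈⟨ ≈-trans (≈-trans copy-⊗ (refl⟩∘⟨ ≈-trans (≈-sym identityˡ ⟩⊗⟨ copy-⊗) ⊗-∘) ⟩∘⟨ ≈-refl) (≈-trans assoc (refl⟩∘⟨ assoc)) ⟩
    interchange ∘ (id ⊗₁ interchange) ∘ (copy ⊗₁ (copy ⊗₁ copy)) ∘ α⇒ ≈⟨ refl⟩∘⟨ refl⟩∘⟨ α-natural ⟨
    interchange ∘ (id ⊗₁ interchange) ∘ α⇒ ∘ ((copy ⊗₁ copy) ⊗₁ copy) ≈⟨ ≈-trans assoc (refl⟩∘⟨ assoc) ⟨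
    (interchange ∘ (id ⊗₁ interchange) ∘ α⇒) ∘ ((copy ⊗₁ copy) ⊗₁ copy) ≈⟨ interchange-assoc ⟩∘⟨ ≈-refl ⟨
    ((α⇒ ⊗₁ α⇒) ∘ interchange ∘ (interchange ⊗₁ id)) ∘ ((copy ⊗₁ copy) ⊗₁ copy) ≈⟨ ≈-trans assoc (refl⟩∘⟨ assoc) ⟩
    (α⇒ ⊗₁ α⇒) ∘ interchange ∘ (interchange ⊗₁ id) ∘ ((copy ⊗₁ copy) ⊗₁ copy) ≈⟨ refl⟩∘⟨ refl⟩∘⟨ ≈-trans (≈-sym ⊗-∘) (≈-sym copy-⊗ ⟩⊗⟨ identityˡ) ⟩
    (α⇒ ⊗₁ α⇒) ∘ interchange ∘ (copy ⊗₁ copy) ≈⟨ refl⟩∘⟨ copy-⊗ ⟨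
    (α⇒ ⊗₁ α⇒) ∘ copy ∎

  λ-deterministic : ∀ {A} → Deterministic (λ⇒ {A})
  λ-deterministic = begin
    copy ∘ λ⇒ ≈⟨ λ-natural ⟨
    λ⇒ ∘ (id ⊗₁ copy) ≈⟨ interchange-unit ⟩∘⟨ ≈-refl ⟨
    ((λ⇒ ⊗₁ λ⇒) ∘ interchange ∘ (λ⇐ ⊗₁ id)) ∘ (id ⊗₁ copy) ≈⟨ ≈-trans assoc (refl⟩∘⟨ assoc) ⟩
    (λ⇒ ⊗₁ λ⇒) ∘ interchange ∘ (λ⇐ ⊗₁ id) ∘ (id ⊗₁ copy) ≈⟨ refl⟩∘⟨ refl⟩∘⟨ ≈-trans (≈-sym ⊗-∘) (≈-trans identityʳ (≈-sym copy-unit) ⟩⊗⟨ identityˡ) ⟩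
    (λ⇒ ⊗₁ λ⇒) ∘ interchange ∘ (copy ⊗₁ copy) ≈⟨ refl⟩∘⟨ copy-⊗ ⟨
    (λ⇒ ⊗₁ λ⇒) ∘ copy ∎

  ⊗id-inverse : ∀ {A B C} {f : A ⇒ B} {g : B ⇒ A} → g ∘ f ≈ id → (g ⊗₁ id {C}) ∘ (f ⊗₁ id) ≈ id
  ⊗id-inverse p = ≈-trans ∘⊗id (≈-trans (p ⟩⊗⟨ ≈-refl) ⊗-id)

  α⇐-deterministic : ∀ {A B C} → Deterministic (α⇐ {A} {B} {C})
  α⇐-deterministic = inverse-deterministic α-isoˡ α-isoʳ α-deterministic

  λ⇐-deterministic : ∀ {A} → Deterministic (λ⇐ {A})
  λ⇐-deterministic = inverse-deterministic λ-isoˡ λ-isoʳ λ-deterministic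

  del-deterministic : ∀ {A} → Deterministic (del {A})
  del-deterministic = monic λ-isoˡ into-unit

  exr-deterministic : ∀ {A B} → Deterministic (exr {A} {B})
  exr-deterministic = ∘-deterministic λ-deterministic (⊗-deterministic del-deterministic id-deterministic)

  exl-⟨⟩ : ∀ {A B C} {f : A ⇒ B} {g : A ⇒ C} → exl ∘ ⟨ f , g ⟩ ≈ f
  exl-⟨⟩ {f = f} {g} = begin
    (ρ⇒ ∘ (id ⊗₁ del)) ∘ (f ⊗₁ g) ∘ copy ≈⟨ assoc ⟩
    ρ⇒ ∘ (id ⊗₁ del) ∘ (f ⊗₁ g) ∘ copy
      ≈⟨ refl⟩∘⟨ pullˡ (≈-trans (≈-sym ⊗-∘) (≈-trans (≈-trans identityˡ (≈-sym identityʳ) ⟩⊗⟨ ≈-trans into-unit (≈-sym identityˡ)) ⊗-∘)) ⟩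
    ρ⇒ ∘ ((f ⊗₁ id) ∘ (id ⊗₁ del)) ∘ copy ≈⟨ refl⟩∘⟨ assoc ⟩
    ρ⇒ ∘ (f ⊗₁ id) ∘ (id ⊗₁ del) ∘ copy ≈⟨ extend ρ-natural ⟩
    f ∘ ρ⇒ ∘ (id ⊗₁ del) ∘ copy ≈⟨ refl⟩∘⟨ copy-unitʳ ⟩
    f ∘ id ≈⟨ identityʳ ⟩
    f ∎

  exr-⟨⟩ : ∀ {A B C} {f : A ⇒ B} {g : A ⇒ C} → exr ∘ ⟨ f , g ⟩ ≈ g
  exr-⟨⟩ {f = f} {g} = begin
    (λ⇒ ∘ (del ⊗₁ id)) ∘ (f ⊗₁ g) ∘ copy ≈⟨ assoc ⟩
    λ⇒ ∘ (del ⊗₁ id) ∘ (f ⊗₁ g) ∘ copy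
      ≈⟨ refl⟩∘⟨ pullˡ (≈-trans (≈-sym ⊗-∘) (≈-trans (≈-trans into-unit (≈-sym identityˡ) ⟩⊗⟨ ≈-trans identityˡ (≈-sym identityʳ)) ⊗-∘)) ⟩
    λ⇒ ∘ ((id ⊗₁ g) ∘ (del ⊗₁ id)) ∘ copy ≈⟨ refl⟩∘⟨ assoc ⟩
    λ⇒ ∘ (id ⊗₁ g) ∘ (del ⊗₁ id) ∘ copy ≈⟨ extend λ-natural ⟩
    g ∘ λ⇒ ∘ (del ⊗₁ id) ∘ copy ≈⟨ refl⟩∘⟨ copy-unitˡ ⟩
    g ∘ id ≈⟨ identityʳ ⟩
    g ∎

  ⟨⟩-cong : ∀ {A B C} {f f′ : A ⇒ B} {g g′ : A ⇒ C} → f ≈ f′ → g ≈ g′ → ⟨ f , g ⟩ ≈ ⟨ f′ , g′ ⟩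
  ⟨⟩-cong p q = (p ⟩⊗⟨ q) ⟩∘⟨ ≈-refl

  ⟨⟩-∘ : ∀ {A B C D} {f : B ⇒ C} {g : B ⇒ D} {h : A ⇒ B} → Deterministic h →
         ⟨ f , g ⟩ ∘ h ≈ ⟨ f ∘ h , g ∘ h ⟩
  ⟨⟩-∘ d = ≈-trans assoc (≈-trans (refl⟩∘⟨ d) (pullˡ (≈-sym ⊗-∘)))

  ⟨exl,exr⟩ : ∀ {A B} → ⟨ exl {A} {B} , exr ⟩ ≈ id
  ⟨exl,exr⟩ = begin
    ((ρ⇒ ∘ (id ⊗₁ del)) ⊗₁ (λ⇒ ∘ (del ⊗₁ id))) ∘ copy ≈⟨ ⊗-∘ ⟩∘⟨ copy-⊗ ⟩
    ((ρ⇒ ⊗₁ λ⇒) ∘ ((id ⊗₁ del) ⊗₁ (del ⊗₁ id))) ∘ interchange ∘ (copy ⊗₁ copy) ≈⟨ assoc ⟩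
    (ρ⇒ ⊗₁ λ⇒) ∘ ((id ⊗₁ del) ⊗₁ (del ⊗₁ id)) ∘ interchange ∘ (copy ⊗₁ copy)
      ≈⟨ refl⟩∘⟨ extend (≈-sym interchange-natural) ⟩
    (ρ⇒ ⊗₁ λ⇒) ∘ interchange ∘ ((id ⊗₁ del) ⊗₁ (del ⊗₁ id)) ∘ (copy ⊗₁ copy)
      ≈⟨ refl⟩∘⟨ ≈-trans (interchange-middle ⟩∘⟨ ≈-refl) identityˡ ⟩
    (ρ⇒ ⊗₁ λ⇒) ∘ ((id ⊗₁ del) ⊗₁ (del ⊗₁ id)) ∘ (copy ⊗₁ copy)
      ≈⟨ ≈-trans (refl⟩∘⟨ ≈-sym ⊗-∘) (≈-sym ⊗-∘) ⟩
    (ρ⇒ ∘ (id ⊗₁ del) ∘ copy) ⊗₁ (λ⇒ ∘ (del ⊗₁ id) ∘ copy)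
      ≈⟨ ≈-trans (copy-unitʳ ⟩⊗⟨ copy-unitˡ) ⊗-id ⟩
    id ∎
    where
    σ-unit : σ {unit} {unit} ≈ id
    σ-unit = monic λ-isoˡ into-unit

    swapFront-unit : ∀ {B} → swapFront {unit} {unit} {B} ≈ id
    swapFront-unit = ≈-trans (refl⟩∘⟨ ≈-trans (≈-trans (σ-unit ⟩⊗⟨ ≈-refl) ⊗-id ⟩∘⟨ ≈-refl) identityˡ) α-isoʳ

    interchange-middle : ∀ {A B} → interchange {A} {unit} {unit} {B} ≈ id
    interchange-middle = ≈-trans
      (refl⟩∘⟨ ≈-trans (≈-trans (≈-refl ⟩⊗⟨ swapFront-unit) ⊗-id ⟩∘⟨ ≈-refl) identityˡ) α-isoˡ

module Tensor {o ℓ e} (C : MarkovCategory o ℓ e) where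
  open MarkovCategory C
  open MarkovProperties C

  private variable
    t t′ : Level
    T : Set t
    T′ : Set t′

  ⨂ : (T → Obj) → List T → Obj
  ⨂ F []       = unit
  ⨂ F (x ∷ xs) = F x ⊗₀ ⨂ F xs

  ⨂-map : {F G : T → Obj} → (∀ x → F x ⇒ G x) → ∀ xs → ⨂ F xs ⇒ ⨂ G xs
  ⨂-map f []       = id
  ⨂-map f (x ∷ xs) = f x ⊗₁ ⨂-map f xs

  ⨂-state : {F : T → Obj} → (∀ x → unit ⇒ F x) → ∀ xs → unit ⇒ ⨂ F xs
  ⨂-state s []       = id
  ⨂-state s (x ∷ xs) = (s x ⊗₁ ⨂-state s xs) ∘ λ⇐

  split : {F : T → Obj} → ∀ xs ys → ⨂ F (xs ++ ys) ⇒ ⨂ F xs ⊗₀ ⨂ F ys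
  split []       ys = λ⇐
  split (x ∷ xs) ys = α⇐ ∘ (id ⊗₁ split xs ys)

  join : {F : T → Obj} → ∀ xs ys → ⨂ F xs ⊗₀ ⨂ F ys ⇒ ⨂ F (xs ++ ys)
  join []       ys = λ⇒
  join (x ∷ xs) ys = (id ⊗₁ join xs ys) ∘ α⇒

  -- ⨂_{x} ⨂_{y ∈ g x} F y  ≅  ⨂ over the concatenated list
  flatten : {F : T → Obj} (g : T′ → List T) → ∀ xs →
            ⨂ (λ x → ⨂ F (g x)) xs ⇒ ⨂ F (concatMap g xs)
  flatten g []       = id
  flatten g (x ∷ xs) = join (g x) (concatMap g xs) ∘ (id ⊗₁ flatten g xs)

  -- For τ x : ⨂ F (π x) ⇒ G x, the tensor product of the τ x along a list.
  alongList : {F : T → Obj} {G : T′ → Obj} (π : T′ → List T) →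
              (∀ x → ⨂ F (π x) ⇒ G x) → ∀ xs → ⨂ F (concatMap π xs) ⇒ ⨂ G xs
  alongList π τ []       = id
  alongList π τ (x ∷ xs) = (τ x ⊗₁ alongList π τ xs) ∘ split (π x) (concatMap π xs)

  module _ {T : Set t} {F : T → Obj} where

    project : ∀ {x xs} → x ∈ xs → ⨂ F xs ⇒ F x
    project (here refl) = exl
    project (there x∈)  = project x∈ ∘ exr

    wire : ∀ {xs ys} → ys ⊆ xs → ⨂ F xs ⇒ ⨂ F ys
    wire {ys = []}     ys⊆xs = del
    wire {ys = y ∷ ys} ys⊆xs =
      ⟨ project (ys⊆xs (here refl)) , wire (λ y∈ → ys⊆xs (there y∈)) ⟩

    -- For lists of distinct variables this is the only permutation there is.
    permute : ∀ {xs ys} → xs ↭ ys → ⨂ F xs ⇒ ⨂ F ys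
    permute p = wire (∈-resp-↭ (↭-sym p))

  split-deterministic : {F : T → Obj} → ∀ xs ys → Deterministic (split {F = F} xs ys)
  split-deterministic []       ys = λ⇐-deterministic
  split-deterministic (x ∷ xs) ys =
    ∘-deterministic α⇐-deterministic (⊗-deterministic id-deterministic (split-deterministic xs ys))

  alongList-deterministic :
    {F : T → Obj} {G : T′ → Obj} (π : T′ → List T) (τ : ∀ x → ⨂ F (π x) ⇒ G x) →
    (∀ x → Deterministic (τ x)) → ∀ xs → Deterministic (alongList π τ xs)
  alongList-deterministic π τ τ-det []       = id-deterministic
  alongList-deterministic π τ τ-det (x ∷ xs) =
    ∘-deterministic (⊗-deterministic (τ-det x) (alongList-deterministic π τ τ-det xs))
                    (split-deterministic (π x) (concatMap π xs))

  module _ {T : Set t} {F : T → Obj} where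

    wire-cong : ∀ {xs ys} (p q : ys ⊆ xs) → (∀ {y} (y∈ : y ∈ ys) → p y∈ ≡ q y∈) →
                wire {F = F} p ≈ wire q
    wire-cong {ys = []}     p q p≗q = ≈-refl
    wire-cong {ys = y ∷ ys} p q p≗q rewrite p≗q (here refl) =
      ⟨⟩-cong ≈-refl (wire-cong _ _ (λ y∈ → p≗q (there y∈)))

    project-wire : ∀ {xs ys y} (p : ys ⊆ xs) (y∈ : y ∈ ys) →
                   project {F = F} y∈ ∘ wire p ≈ project (p y∈)
    project-wire p (here refl) = exl-⟨⟩
    project-wire p (there y∈)  =
      ≈-trans assoc (≈-trans (refl⟩∘⟨ exr-⟨⟩) (project-wire (λ z∈ → p (there z∈)) y∈))

    wire-there : ∀ {x xs ys} (p : ys ⊆ xs) →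
                 wire {F = F} (λ y∈ → there {x = x} (p y∈)) ≈ wire p ∘ exr
    wire-there {ys = []}     p = into-unit
    wire-there {ys = y ∷ ys} p = ≈-trans
      (⟨⟩-cong ≈-refl (wire-there (λ y∈ → p (there y∈)))) (≈-sym (⟨⟩-∘ exr-deterministic))

    wire-id : ∀ xs → wire {F = F} {xs} (λ x∈ → x∈) ≈ id
    wire-id []       = into-unit
    wire-id (x ∷ xs) = ≈-trans
      (⟨⟩-cong ≈-refl (≈-trans (wire-there {xs = xs} (λ x∈ → x∈)) (≈-trans (wire-id xs ⟩∘⟨ ≈-refl) identityˡ)))
      ⟨exl,exr⟩

    wire-wire : ∀ {A xs ys zs} (p : zs ⊆ ys) (q : ys ⊆ xs)
                {f : A ⇒ ⨂ F xs} {g : A ⇒ ⨂ F ys} → Deterministic f → Deterministic g →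
                wire q ∘ f ≈ g → wire p ∘ g ≈ wire (λ z∈ → q (p z∈)) ∘ f
    wire-wire {zs = []}     p q f-det g-det eq = into-unit
    wire-wire {zs = z ∷ zs} p q f-det g-det eq = ≈-trans (⟨⟩-∘ g-det) (≈-trans
      (⟨⟩-cong (≈-trans (refl⟩∘⟨ ≈-sym eq) (pullˡ (project-wire q (p (here refl)))))
               (wire-wire (λ z∈ → p (there z∈)) q f-det g-det eq))
      (≈-sym (⟨⟩-∘ f-det)))

module _ {o ℓ e} (C : MarkovCategory o ℓ e) where
  open MarkovCategory C
  open Tensor C

  record FCM : Set (o ⊔ ℓ ⊔ e) where
    field
      n : ℕ

    V : Set
    V = Fin n

    field
      object         : V → Obj
      exogenous      : V → Obj
      parents        : V → List V
      parents-unique : ∀ i → Unique (parents i)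

    _↝_ : Rel V _
    i ↝ j = i ∈ parents j

    -- Exogenous variables have no parents, so they lie on no cycle.
    field
      acyclic   : ∀ i → ¬ TransClosure _↝_ i i
      noise     : ∀ i → unit ⇒ exogenous i
      mechanism : ∀ i → ⨂ object (parents i) ⊗₀ exogenous i ⇒ object i
      mechanism-deterministic : ∀ i → Deterministic (mechanism i)

    U : Obj
    U = ⨂ exogenous (allFin n)

    exogenousState : unit ⇒ U
    exogenousState = ⨂-state noise (allFin n)

  module _ (M : FCM) where
    open FCM M
    open MarkovProperties C using (≈-refl; ≈-trans; ≈-sym; _⟩∘⟨_)

    -- A diagram from the inputs U and Γ which computes, in this order and
    -- each exactly once, the variables that Δ has in addition to Γ.
    data Diagram (Γ : List V) : List V → Set where
      start : Diagram Γ Γ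
      step  : ∀ {Δ} → Diagram Γ Δ → ∀ i → i ∉ Δ → parents i ⊆ Δ → Diagram Γ (i ∷ Δ)

    channel : ∀ {Γ Δ} → Diagram Γ Δ → U ⊗₀ ⨂ object Γ ⇒ U ⊗₀ ⨂ object Δ
    channel start               = id
    channel (step D i i∉Δ pa⊆Δ) =
      ⟨ exl , ⟨ mechanism i ∘ ⟨ wire pa⊆Δ ∘ exr , project (∈-allFin i) ∘ exl ⟩ , exr ⟩ ⟩
        ∘ channel D

    open DecMembership (Fin._≟_ {n}) using (_∈?_)

    ↝-wellFounded : WellFounded _↝_
    ↝-wellFounded = Plus.wellFounded⁻ _↝_ (spo-wellFounded isStrictPartialOrder)
      where
      isStrictPartialOrder : IsStrictPartialOrder _≡_ (TransClosure _↝_)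
      isStrictPartialOrder = record
        { isEquivalence = isEquivalence
        ; irrefl        = λ { refl → acyclic _ }
        ; trans         = Plus._++_
        ; <-resp-≈      = resp₂ _
        }

    module _ (Γ : List V) where

      Extension : List V → List V → Set
      Extension Δ is = ∃[ Δ′ ] Diagram Γ Δ′ × Δ ⊆ Δ′ × is ⊆ Δ′

      Reachable : V → Set
      Reachable i = ∀ {Δ} → Diagram Γ Δ → Extension Δ (i ∷ [])

      reachAll : ∀ is → (∀ {i} → i ∈ is → Reachable i) → ∀ {Δ} → Diagram Γ Δ → Extension Δ is
      reachAll []       reach D = _ , D , (λ j∈ → j∈) , λ ()
      reachAll (i ∷ is) reach D with reach (here refl) D
      ... | _ , D₁ , Δ⊆Δ₁ , i⊆Δ₁ with reachAll is (λ j∈ → reach (there j∈)) D₁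
      ... | _ , D₂ , Δ₁⊆Δ₂ , is⊆Δ₂ =
        _ , D₂ , (λ j∈ → Δ₁⊆Δ₂ (Δ⊆Δ₁ j∈)) ,
        λ { (here refl) → Δ₁⊆Δ₂ (i⊆Δ₁ (here refl)) ; (there j∈) → is⊆Δ₂ j∈ }

      reach : ∀ i → Reachable i
      reach = WF.wfRec ↝-wellFounded _ Reachable reach′
        where
        reach′ : ∀ i → (∀ {j} → j ↝ i → Reachable j) → Reachable i
        reach′ i reachParent D with reachAll (parents i) reachParent D
        ... | Δ₁ , D₁ , Δ⊆Δ₁ , pa⊆Δ₁ with i ∈? Δ₁
        ... | yes i∈Δ₁ = _ , D₁ , Δ⊆Δ₁ , λ { (here refl) → i∈Δ₁ }
        ... | no  i∉Δ₁ =
          _ , step D₁ i i∉Δ₁ pa⊆Δ₁ , (λ j∈ → there (Δ⊆Δ₁ j∈)) , λ { (here refl) → here refl }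

      complete : Extension Γ (allFin n)
      complete = reachAll (allFin n) (λ {i} _ → reach i) start

    -- F_{Do(X)}^Y.  The mechanisms of the variables in X are not used,
    -- since Diagram X Δ only extends by variables outside of Δ ⊇ X.
    Do : ∀ X Y → U ⊗₀ ⨂ object X ⇒ ⨂ object Y
    Do X Y with complete X
    ... | _ , D , _ , all⊆Δ = wire {ys = Y} (λ {i} _ → all⊆Δ (∈-allFin i)) ∘ exr ∘ channel D

    -- Y|ₓ, with x a sharp state of X
    record Component : Set (ℓ ⊔ e) where
      constructor component
      field
        Y        : List V
        Y-unique : Unique Y
        X        : List V
        X-unique : Unique X
        x        : SharpState (⨂ object X)
      open SharpState x public using (state; deterministic)

    CFQuery : Set (ℓ ⊔ e)
    CFQuery = List Component

    open Component

    -- Sets of variables are lists of distinct variables up to permutation.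
    record _≋ᶜ_ (c d : Component) : Set e where
      constructor mk≋ᶜ
      field
        Y↭ : Y c ↭ Y d
        X↭ : X c ↭ X d
        x≈ : permute X↭ ∘ state c ≈ state d

    _≋ᵠ_ : Rel CFQuery (ℓ ⊔ e)
    _≋ᵠ_ = Pointwise _≋ᶜ_

    ≋ᶜ-isEquivalence : IsEquivalence _≋ᶜ_
    ≋ᶜ-isEquivalence = record
      { refl  = λ {c} → mk≋ᶜ ↭-refl ↭-refl
          (≈-trans (wire-id (X c) ⟩∘⟨ ≈-refl) identityˡ)
      ; sym   = λ {c} {d} (mk≋ᶜ Y↭ X↭ x≈) → mk≋ᶜ (↭-sym Y↭) (↭-sym X↭)
          (≈-trans (wire-wire {F = object} {ys = X d} {X c} _ _ (deterministic c) (deterministic d) x≈)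
          (≈-trans (wire-cong {F = object} {X c} {X c} _ _ (∈-resp-[σ∘σ⁻¹] (↭-sym X↭)) ⟩∘⟨ ≈-refl)
          (≈-trans (wire-id (X c) ⟩∘⟨ ≈-refl) identityˡ)))
      ; trans = λ {c} {d} {k} (mk≋ᶜ Y↭ X↭ x≈) (mk≋ᶜ Y↭′ X↭′ x≈′) →
          mk≋ᶜ (_↭_.trans Y↭ Y↭′) (_↭_.trans X↭ X↭′)
          (≈-trans (≈-sym (wire-wire {F = object} {ys = X d} {X k} _ _ (deterministic c) (deterministic d) x≈)) x≈′)
      }

    cfQueries : Setoid (ℓ ⊔ e) (ℓ ⊔ e)
    cfQueries = record { isEquivalence = Pointwise.isEquivalence ≋ᶜ-isEquivalence }

    copyU : (q : CFQuery) → U ⇒ ⨂ (λ _ → U) q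
    copyU []      = del
    copyU (_ ∷ q) = ⟨ id , copyU q ⟩

    pairUp : ∀ {F G : Component → Obj} q → ⨂ F q ⊗₀ ⨂ G q ⇒ ⨂ (λ c → F c ⊗₀ G c) q
    pairUp []      = λ⇒
    pairUp (_ ∷ q) = (id ⊗₁ pairUp q) ∘ interchange

    ⟦_⟧ : (q : CFQuery) → unit ⇒ ⨂ (λ c → ⨂ object (Y c)) q
    ⟦ q ⟧ = ⨂-map (λ c → Do (X c) (Y c)) q
          ∘ pairUp q
          ∘ ((copyU q ∘ exogenousState) ⊗₁ ⨂-state state q)
          ∘ λ⇐

record Signature (t q r : Level) : Set (lsuc (t ⊔ q ⊔ r)) where
  field
    Type    : Set t
    queries : Setoid q r
  open Setoid queries public using () renaming (Carrier to Query; _≈_ to _≋_)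
  field
    inputs outputs : Query → List Type

module _ {o ℓ e} (C : MarkovCategory o ℓ e) where
  open MarkovCategory C
  open Tensor C

  record Model {t q r} (S : Signature t q r) : Set (o ⊔ ℓ ⊔ t ⊔ q) where
    open Signature S
    field
      ⟦_⟧₀ : Type → Obj
      ⟦_⟧₁ : ∀ q → ⨂ ⟦_⟧₀ (inputs q) ⇒ ⨂ ⟦_⟧₀ (outputs q)

  module _ {tL qL rL tH qH rH r : Level} {SL : Signature tL qL rL} {SH : Signature tH qH rH} where
    private
      module SL = Signature SL
      module SH = Signature SH

    -- ω is given by its graph; "ω q = q′" reads "ω q q′".  Queries matter only up
    -- to _≋_, and the graph relates representatives that are typed on the nose.
    record IsUpwardAbstraction
      (ML : Model SL) (MH : Model SH)
      (π : SH.Type → List SL.Type)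
      (τ : ∀ X → ⨂ (Model.⟦_⟧₀ ML) (π X) ⇒ Model.⟦_⟧₀ MH X)
      (ω : REL SL.Query SH.Query r)
      : Set (o ⊔ ℓ ⊔ e ⊔ tL ⊔ qL ⊔ rL ⊔ tH ⊔ qH ⊔ rH ⊔ r) where
      private
        module ML = Model ML
        module MH = Model MH
      field
        τ-deterministic : ∀ X → Deterministic (τ X)
        τ-epic          : ∀ X → Epic (τ X)
        τ-list-epic     : ∀ Xs → Epic (alongList π τ Xs)
        ω-functional    : ∀ {q₁ q₂ q₁′ q₂′} → ω q₁ q₁′ → ω q₂ q₂′ → q₁ SL.≋ q₂ → q₁′ SH.≋ q₂′
        ω-surjective    : ∀ q′ → ∃[ q ] ∃[ q″ ] ω q q″ × q″ SH.≋ q′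
        ω-inputs        : ∀ {q q′} → ω q q′ → SL.inputs q ≡ concatMap π (SH.inputs q′)
        ω-outputs       : ∀ {q q′} → ω q q′ → SL.outputs q ≡ concatMap π (SH.outputs q′)
        ω-natural       : ∀ {q q′} (w : ω q q′) →
          alongList π τ (SH.outputs q′)
            ∘ subst₂ (λ A B → ⨂ ML.⟦_⟧₀ A ⇒ ⨂ ML.⟦_⟧₀ B) (ω-inputs w) (ω-outputs w) ML.⟦ q ⟧₁
          ≈ MH.⟦ q′ ⟧₁ ∘ alongList π τ (SH.inputs q′)

  module _ (M : FCM C) where
    open FCM M

    CFᶜ : Signature _ _ _
    CFᶜ = record
      { Type    = V
      ; queries = cfQueries C M
      ; inputs  = λ _ → []
      ; outputs = concatMap Component.Y
      }

    restrict : ∀ {p} → Pred (CFQuery C M) p → Signature _ _ _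
    restrict Q = record
      { Type    = V
      ; queries = On.setoid {B = Σ (CFQuery C M) Q} (cfQueries C M) proj₁
      ; inputs  = λ _ → []
      ; outputs = λ (q , _) → concatMap Component.Y q
      }

    modelCFᶜ : Model CFᶜ
    modelCFᶜ = record
      { ⟦_⟧₀ = object
      ; ⟦_⟧₁ = λ q → flatten Component.Y q ∘ ⟦_⟧ C M q
      }

    modelRestrict : ∀ {p} (Q : Pred (CFQuery C M) p) → Model (restrict Q)
    modelRestrict Q = record
      { ⟦_⟧₀ = object
      ; ⟦_⟧₁ = λ (q , _) → Model.⟦_⟧₁ modelCFᶜ q
      }

  module _ (L H : FCM C) where
    private
      module L = FCM L
      module H = FCM H

    record VariableAlignment : Set (o ⊔ ℓ ⊔ e) where
      field
        π          : H.V → List L.V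
        π-unique   : ∀ X → Unique (π X)
        π-disjoint : ∀ {X Y} → X ≢ Y → Disjoint (π X) (π Y)
        τ          : ∀ X → ⨂ L.object (π X) ⇒ H.object X
        τ-deterministic : ∀ X → Deterministic (τ X)
        τ-epic          : ∀ X → Epic (τ X)

      π* : List H.V → List L.V
      π* = concatMap π

      τ* : ∀ S → ⨂ L.object (π* S) ⇒ ⨂ H.object S
      τ* = alongList π τ

      -- S may repeat variables: the outputs of a query need not be disjoint.
      field
        τ*-epic : ∀ S → Epic (τ* S)

      π*-unique : ∀ {S} → Unique S → Unique (π* S)
      π*-unique {S} S-unique = Unique.concat⁺
        (All.map⁺ (All.universal π-unique S))
        (AllPairs.map⁺ (AllPairs.map π-disjoint S-unique))

      infix 10 τ*_·_
      τ*_·_ : ∀ S → SharpState (⨂ L.object (π* S)) → SharpState (⨂ H.object S)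
      τ* S · sharp x x-det = sharp (τ* S ∘ x)
        (MarkovProperties.∘-deterministic C
          (alongList-deterministic π τ τ-deterministic S) x-det)

  module _ {L H : FCM C} (A : VariableAlignment L H) where
    open VariableAlignment A
    private
      module L = FCM L
      module H = FCM H

    record AlignedComponent : Set (ℓ ⊔ e) where
      field
        Y        : List H.V
        Y-unique : Unique Y
        X        : List H.V
        X-unique : Unique X
        x        : SharpState (⨂ L.object (π* X))

      low : Component C L
      low = component (π* Y) (π*-unique Y-unique) (π* X) (π*-unique X-unique) x

      high : Component C H
      high = component Y Y-unique X X-unique (τ* X · x)

    open AlignedComponent

    lowQuery : List AlignedComponent → CFQuery C L
    lowQuery = map low

    highQuery : List AlignedComponent → CFQuery C H
    highQuery = map high

    -- τ_{Y₁} ⊗ … ⊗ τ_{Yₘ}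
    τ-outputs : ∀ q → ⨂ (λ c → ⨂ L.object (Component.Y c)) (lowQuery q)
                    ⇒ ⨂ (λ c → ⨂ H.object (Component.Y c)) (highQuery q)
    τ-outputs []      = id
    τ-outputs (c ∷ q) = τ* (Y c) ⊗₁ τ-outputs q

    module _ {p} (Q : Pred (CFQuery C H) p) where

      Consistent : Set (ℓ ⊔ e ⊔ p)
      Consistent = ∀ q → Q (highQuery q) →
        τ-outputs q ∘ ⟦_⟧ C L (lowQuery q) ≈ ⟦_⟧ C H (highQuery q)

      data ω : REL (CFQuery C L) (Σ (CFQuery C H) Q) (ℓ ⊔ e ⊔ p) where
        maps : ∀ q (q∈Q : Q (highQuery q)) → ω (lowQuery q) (highQuery q , q∈Q)

      DeterminesUpwardAbstraction : Set (o ⊔ ℓ ⊔ e ⊔ p)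
      DeterminesUpwardAbstraction =
        IsUpwardAbstraction {SL = CFᶜ L} {SH = restrict H Q} (modelCFᶜ L) (modelRestrict H Q) π τ ω

{-# OPTIONS --safe #-}
module Submission where

-- Consistency at a query and naturality of ω at that query are the same equation
-- up to the isomorphism which flattens the tensor of the outputs Y₁, …, Yₘ into a
-- single list.  What remains is that ω is well defined on queries up to reordering:
-- the blocks π(X) are nonempty and disjoint, so π(S) determines the set S, and the
-- components of τ_S ∘ x are each computed from one block of x, so they do not
-- depend on the order in which S is listed.

open import Data.Empty using (⊥-elim)
import Data.Fin.Properties as Fin
open import Data.List using (List; []; _∷_; _++_; concatMap)
open import Data.List.Membership.Propositional using (_∈_)
open import Data.List.Membership.Propositional.Properties using (∈-++⁺ˡ; ∈-++⁺ʳ; ∈-++⁻)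
open import Data.List.Membership.Propositional.Properties.WithK using (unique⇒irrelevant; unique∧set⇒bag)
open import Data.List.Properties using (++-assoc; concatMap-++)
open import Data.List.Relation.Binary.BagAndSetEquality using (∼bag⇒↭)
open import Data.List.Relation.Binary.Permutation.Propositional using (_↭_; ↭-sym)
open import Data.List.Relation.Binary.Permutation.Propositional.Properties using (∈-resp-↭)
import Data.List.Relation.Binary.Pointwise as Pointwise
open import Data.List.Relation.Binary.Subset.Propositional using (_⊆_)
open import Data.List.Relation.Unary.Any using (here; there)
open import Data.List.Relation.Unary.Unique.Propositional using (Unique)
open import Data.Product using (_×_; _,_; ∃-syntax)
open import Data.Sum using (inj₁; inj₂)
open import Function using (mk⇔)
open import Level using (Level)
open import Relation.Binary using (IsEquivalence)
import Relation.Binary.Reasoning.Setoid as SetoidReasoning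
open import Relation.Binary.PropositionalEquality
  using (_≡_; _≢_; refl; sym; trans; cong; subst₂)
open import Relation.Nullary using (yes; no)
open import Relation.Unary using (Pred)
open import Defs

-- Naturality and coherence of the two projections

module Projections {o ℓ e} (C : MarkovCategory o ℓ e) where
  open MarkovCategory C
  open MarkovProperties C

  private module ⇒-Reasoning {A B} = SetoidReasoning (hom {A} {B})
  open ⇒-Reasoning

  -- The unit is terminal, so `g` followed by `del` is `del`; projections are therefore natural for
  -- all channels, deterministic or not.
  exl-natural : ∀ {A B A′ B′} {f : A ⇒ A′} {g : B ⇒ B′} → exl ∘ (f ⊗₁ g) ≈ f ∘ exl
  exl-natural {f = f} {g} = begin
    (ρ⇒ ∘ (id ⊗₁ del)) ∘ (f ⊗₁ g) ≈⟨ assoc ⟩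
    ρ⇒ ∘ (id ⊗₁ del) ∘ (f ⊗₁ g)   ≈⟨ refl⟩∘⟨ ⊗-∘ ⟨
    ρ⇒ ∘ ((id ∘ f) ⊗₁ (del ∘ g))  ≈⟨ refl⟩∘⟨ (≈-trans identityˡ (≈-sym identityʳ) ⟩⊗⟨ ≈-trans into-unit (≈-sym identityˡ)) ⟩
    ρ⇒ ∘ ((f ∘ id) ⊗₁ (id ∘ del)) ≈⟨ refl⟩∘⟨ ⊗-∘ ⟩
    ρ⇒ ∘ (f ⊗₁ id) ∘ (id ⊗₁ del)  ≈⟨ extend ρ-natural ⟩
    f ∘ exl ∎

  exr-natural : ∀ {A B A′ B′} {f : A ⇒ A′} {g : B ⇒ B′} → exr ∘ (f ⊗₁ g) ≈ g ∘ exr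
  exr-natural {f = f} {g} = begin
    (λ⇒ ∘ (del ⊗₁ id)) ∘ (f ⊗₁ g) ≈⟨ assoc ⟩
    λ⇒ ∘ (del ⊗₁ id) ∘ (f ⊗₁ g)   ≈⟨ refl⟩∘⟨ ⊗-∘ ⟨
    λ⇒ ∘ ((del ∘ f) ⊗₁ (id ∘ g))  ≈⟨ refl⟩∘⟨ (≈-trans into-unit (≈-sym identityˡ) ⟩⊗⟨ ≈-trans identityˡ (≈-sym identityʳ)) ⟩
    λ⇒ ∘ ((id ∘ del) ⊗₁ (g ∘ id)) ≈⟨ refl⟩∘⟨ ⊗-∘ ⟩
    λ⇒ ∘ (id ⊗₁ g) ∘ (del ⊗₁ id)  ≈⟨ extend λ-natural ⟩
    g ∘ exr ∎

  -- Since `f` acts after the copy, this holds for every channel. It brings a tensor into the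
  -- pairing form in which `wire` is defined.
  id⊗-⟨⟩ : ∀ {A B D} {f : B ⇒ D} → id {A} ⊗₁ f ≈ ⟨ exl , f ∘ exr ⟩
  id⊗-⟨⟩ {f = f} = begin
    id ⊗₁ f                         ≈⟨ identityʳ ⟨
    (id ⊗₁ f) ∘ id                  ≈⟨ refl⟩∘⟨ ⟨exl,exr⟩ ⟨
    (id ⊗₁ f) ∘ (exl ⊗₁ exr) ∘ copy ≈⟨ pullˡ (≈-sym ⊗-∘) ⟩
    ((id ∘ exl) ⊗₁ (f ∘ exr)) ∘ copy ≈⟨ ⟨⟩-cong identityˡ ≈-refl ⟩
    ⟨ exl , f ∘ exr ⟩ ∎

  -- Tensoring with the unit is faithful, so it suffices to check this after − ⊗ id.
  ρ-α : ∀ {A B} → (id {A} ⊗₁ ρ⇒ {B}) ∘ α⇒ ≈ ρ⇒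
  ρ-α = ⊗unit-faithful (monic {a = α⇒} {b = α⇐} α-isoˡ (begin
    α⇒ ∘ (((id ⊗₁ ρ⇒) ∘ α⇒) ⊗₁ id)                ≈⟨ refl⟩∘⟨ ∘⊗id ⟨
    α⇒ ∘ ((id ⊗₁ ρ⇒) ⊗₁ id) ∘ (α⇒ ⊗₁ id)          ≈⟨ extend α-natural ⟩
    (id ⊗₁ (ρ⇒ ⊗₁ id)) ∘ α⇒ ∘ (α⇒ ⊗₁ id)          ≈⟨ pushˡ (≈-trans (≈-refl ⟩⊗⟨ ≈-sym triangle) (≈-sym id⊗∘)) ⟩
    (id ⊗₁ (id ⊗₁ λ⇒)) ∘ (id ⊗₁ α⇒) ∘ α⇒ ∘ (α⇒ ⊗₁ id) ≈⟨ refl⟩∘⟨ pentagon ⟩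
    (id ⊗₁ (id ⊗₁ λ⇒)) ∘ α⇒ ∘ α⇒                  ≈⟨ extend (≈-sym α-natural) ⟩
    α⇒ ∘ ((id ⊗₁ id) ⊗₁ λ⇒) ∘ α⇒                  ≈⟨ refl⟩∘⟨ ≈-trans ((⊗-id ⟩⊗⟨ ≈-refl) ⟩∘⟨ ≈-refl) triangle ⟩
    α⇒ ∘ (ρ⇒ ⊗₁ id) ∎))
    where
    ⊗unit-faithful : ∀ {A B} {f g : A ⇒ B} → f ⊗₁ id {unit} ≈ g ⊗₁ id → f ≈ g
    ⊗unit-faithful p = epic ρ-isoʳ (≈-trans (≈-sym ρ-natural) (≈-trans (refl⟩∘⟨ p) ρ-natural))

  exl-α⇐ : ∀ {A B D} → exl ∘ α⇐ {A} {B} {D} ≈ id ⊗₁ exl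
  exl-α⇐ = epic α-isoʳ (begin
    (exl ∘ α⇐) ∘ α⇒                       ≈⟨ ≈-trans assoc (≈-trans (refl⟩∘⟨ α-isoˡ) identityʳ) ⟩
    ρ⇒ ∘ (id ⊗₁ del)                      ≈⟨ ≈-sym ρ-α ⟩∘⟨ (≈-sym ⊗-id ⟩⊗⟨ ≈-refl) ⟩
    ((id ⊗₁ ρ⇒) ∘ α⇒) ∘ ((id ⊗₁ id) ⊗₁ del) ≈⟨ ≈-trans assoc (refl⟩∘⟨ α-natural) ⟩
    (id ⊗₁ ρ⇒) ∘ (id ⊗₁ (id ⊗₁ del)) ∘ α⇒ ≈⟨ pullˡ id⊗∘ ⟩
    (id ⊗₁ exl) ∘ α⇒ ∎)

  exr-α⇒ : ∀ {A B D} → exr ∘ α⇒ {A} {B} {D} ≈ exr ⊗₁ id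
  exr-α⇒ = begin
    (λ⇒ ∘ (del ⊗₁ id)) ∘ α⇒                ≈⟨ ≈-trans assoc (refl⟩∘⟨ (≈-refl ⟩⊗⟨ ≈-sym ⊗-id) ⟩∘⟨ ≈-refl) ⟩
    λ⇒ ∘ (del ⊗₁ (id ⊗₁ id)) ∘ α⇒          ≈⟨ refl⟩∘⟨ α-natural ⟨
    λ⇒ ∘ α⇒ ∘ ((del ⊗₁ id) ⊗₁ id)          ≈⟨ pullˡ λ-α ⟩
    (λ⇒ ⊗₁ id) ∘ ((del ⊗₁ id) ⊗₁ id)       ≈⟨ ∘⊗id ⟩
    exr ⊗₁ id ∎

  exr-α⇐ : ∀ {A B D} → exr ∘ α⇐ {A} {B} {D} ≈ exr ∘ exr
  exr-α⇐ = epic α-isoʳ (begin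
    (exr ∘ α⇐) ∘ α⇒ ≈⟨ ≈-trans assoc (≈-trans (refl⟩∘⟨ α-isoˡ) identityʳ) ⟩
    exr             ≈⟨ identityˡ ⟨
    id ∘ exr        ≈⟨ exr-natural ⟨
    exr ∘ (exr ⊗₁ id) ≈⟨ refl⟩∘⟨ exr-α⇒ ⟨
    exr ∘ exr ∘ α⇒  ≈⟨ assoc ⟨
    (exr ∘ exr) ∘ α⇒ ∎)

  exr-λ⇐ : ∀ {A} → exr ∘ λ⇐ {A} ≈ id
  exr-λ⇐ = ≈-trans assoc (≈-trans
    (refl⟩∘⟨ ≈-trans (≈-trans (into-unit ⟩⊗⟨ ≈-refl) ⊗-id ⟩∘⟨ ≈-refl) identityˡ) λ-isoʳ)

  α⇒∘λ⇐⊗id : ∀ {A B} → α⇒ ∘ (λ⇐ {A} ⊗₁ id {B}) ≈ λ⇐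
  α⇒∘λ⇐⊗id = monic λ-isoˡ (≈-trans (pullˡ λ-α) (≈-trans ∘⊗id
    (≈-trans (λ-isoʳ ⟩⊗⟨ ≈-refl) (≈-trans ⊗-id (≈-sym λ-isoʳ)))))

  λ⇐-natural : ∀ {A B} {f : A ⇒ B} → λ⇐ ∘ f ≈ (id ⊗₁ f) ∘ λ⇐
  λ⇐-natural = monic λ-isoˡ (≈-trans (cancelˡ λ-isoʳ) (≈-sym
    (≈-trans (extend λ-natural) (≈-trans (refl⟩∘⟨ λ-isoʳ) identityʳ))))

  pentagon-α⇐ : ∀ {A B D E} → α⇐ ∘ (id {A} ⊗₁ α⇒ {B} {D} {E}) ∘ α⇒ ≈ α⇒ ∘ (α⇐ ⊗₁ id)
  pentagon-α⇐ = epic (⊗id-inverse α-isoʳ) (begin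
    (α⇐ ∘ (id ⊗₁ α⇒) ∘ α⇒) ∘ (α⇒ ⊗₁ id) ≈⟨ ≈-trans assoc (refl⟩∘⟨ assoc) ⟩
    α⇐ ∘ (id ⊗₁ α⇒) ∘ α⇒ ∘ (α⇒ ⊗₁ id)   ≈⟨ refl⟩∘⟨ pentagon ⟩
    α⇐ ∘ α⇒ ∘ α⇒                        ≈⟨ cancelˡ α-isoˡ ⟩
    α⇒                                  ≈⟨ ≈-trans (refl⟩∘⟨ ⊗id-inverse α-isoˡ) identityʳ ⟨
    α⇒ ∘ (α⇐ ⊗₁ id) ∘ (α⇒ ⊗₁ id)        ≈⟨ assoc ⟨
    (α⇒ ∘ (α⇐ ⊗₁ id)) ∘ (α⇒ ⊗₁ id) ∎)

-- Wirings and tensors along lists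

module TensorProperties {o ℓ e} (C : MarkovCategory o ℓ e) where
  open MarkovCategory C
  open MarkovProperties C
  open Projections C
  open Tensor C

  private module ⇒-Reasoning {A B} = SetoidReasoning (hom {A} {B})
  open ⇒-Reasoning

  private variable
    t t′ : Level
    T : Set t
    T′ : Set t′

  -- Deterministic maps see the tensor as a product: `g` is the pairing of its own projections, and
  -- `f` can be moved inside the pairing that defines `wire`. General channels are not determined by
  -- their marginals.
  wire-unique : {F : T → Obj} → ∀ {A xs ys} (p : ys ⊆ xs) {f : A ⇒ ⨂ F xs} {g : A ⇒ ⨂ F ys} →
                Deterministic f → Deterministic g →
                (∀ {y} (y∈ : y ∈ ys) → project (p y∈) ∘ f ≈ project y∈ ∘ g) → wire p ∘ f ≈ g
  wire-unique {ys = []}     p f-det g-det eq = into-unit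
  wire-unique {ys = y ∷ ys} p {f} {g} f-det g-det eq = begin
    ⟨ project (p (here refl)) , wire (λ y∈ → p (there y∈)) ⟩ ∘ f ≈⟨ ⟨⟩-∘ f-det ⟩
    ⟨ project (p (here refl)) ∘ f , wire (λ y∈ → p (there y∈)) ∘ f ⟩
      ≈⟨ ⟨⟩-cong (eq (here refl)) (wire-unique _ f-det (∘-deterministic exr-deterministic g-det)
                                    (λ y∈ → ≈-trans (eq (there y∈)) assoc)) ⟩
    ⟨ exl ∘ g , exr ∘ g ⟩ ≈⟨ ⟨⟩-∘ g-det ⟨
    ⟨ exl , exr ⟩ ∘ g     ≈⟨ ⟨exl,exr⟩ ⟩∘⟨ ≈-refl ⟩
    id ∘ g                ≈⟨ identityˡ ⟩
    g ∎

  exl-split : {F : T → Obj} → ∀ xs ys → exl ∘ split {F = F} xs ys ≈ wire {ys = xs} ∈-++⁺ˡ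
  exl-split []       ys = into-unit
  exl-split {F = F} (x ∷ xs) ys = begin
    exl ∘ α⇐ ∘ (id ⊗₁ split xs ys)          ≈⟨ pullˡ exl-α⇐ ⟩
    (id ⊗₁ exl) ∘ (id ⊗₁ split xs ys)       ≈⟨ id⊗∘ ⟩
    id ⊗₁ (exl ∘ split xs ys)               ≈⟨ id⊗-⟨⟩ ⟩
    ⟨ exl , (exl ∘ split xs ys) ∘ exr ⟩     ≈⟨ ⟨⟩-cong ≈-refl (≈-trans (exl-split xs ys ⟩∘⟨ ≈-refl)
                                                 (≈-sym (wire-there {F = F} {xs = xs ++ ys} {ys = xs} ∈-++⁺ˡ))) ⟩
    wire {ys = x ∷ xs} ∈-++⁺ˡ ∎

  exr-split : {F : T → Obj} → ∀ xs ys → exr ∘ split {F = F} xs ys ≈ wire (λ y∈ → ∈-++⁺ʳ xs y∈)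
  exr-split []       ys = ≈-trans exr-λ⇐ (≈-sym (wire-id ys))
  exr-split (x ∷ xs) ys = begin
    exr ∘ α⇐ ∘ (id ⊗₁ split xs ys)        ≈⟨ extend exr-α⇐ ⟩
    exr ∘ exr ∘ (id ⊗₁ split xs ys)       ≈⟨ refl⟩∘⟨ exr-natural ⟩
    exr ∘ split xs ys ∘ exr               ≈⟨ pullˡ (exr-split xs ys) ⟩
    wire (λ y∈ → ∈-++⁺ʳ xs y∈) ∘ exr      ≈⟨ wire-there (λ y∈ → ∈-++⁺ʳ xs y∈) ⟨
    wire (λ y∈ → ∈-++⁺ʳ (x ∷ xs) y∈) ∎

  -- Recursion on the position makes this reduce to the inclusions in `exl-split` and `exr-split`.
  concatMap-⊆ : (π : T′ → List T) → ∀ {x xs} → x ∈ xs → π x ⊆ concatMap π xs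
  concatMap-⊆ π (here refl)        y∈ = ∈-++⁺ˡ y∈
  concatMap-⊆ π (there {x = z} x∈) y∈ = ∈-++⁺ʳ (π z) (concatMap-⊆ π x∈ y∈)

  -- By naturality of the projections, discarding the other components discards the blocks that feed
  -- them. Only the block of `x` survives.
  project-alongList : {F : T → Obj} {G : T′ → Obj} (π : T′ → List T) (τ : ∀ x → ⨂ F (π x) ⇒ G x) →
    ∀ {x xs} (x∈ : x ∈ xs) →
    project x∈ ∘ alongList {F = F} π τ xs ≈ τ x ∘ wire (concatMap-⊆ π x∈)
  project-alongList π τ {xs = x ∷ xs} (here refl) = begin
    exl ∘ (τ x ⊗₁ alongList π τ xs) ∘ split (π x) _ ≈⟨ extend exl-natural ⟩
    τ x ∘ exl ∘ split (π x) _                       ≈⟨ refl⟩∘⟨ exl-split (π x) _ ⟩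
    τ x ∘ wire {ys = π x} ∈-++⁺ˡ ∎
  project-alongList π τ {x} {z ∷ xs} (there x∈) = begin
    (project x∈ ∘ exr) ∘ (τ z ⊗₁ alongList π τ xs) ∘ split (π z) _ ≈⟨ assoc ⟩
    project x∈ ∘ exr ∘ (τ z ⊗₁ alongList π τ xs) ∘ split (π z) _ ≈⟨ refl⟩∘⟨ extend exr-natural ⟩
    project x∈ ∘ alongList π τ xs ∘ exr ∘ split (π z) _          ≈⟨ extend (project-alongList π τ x∈) ⟩
    τ x ∘ wire (concatMap-⊆ π x∈) ∘ exr ∘ split (π z) _
      -- The projection after `split` is itself a wiring, so `wire-wire`, started from the identity,
      -- fuses the two into one.
      ≈⟨ refl⟩∘⟨ wire-wire (concatMap-⊆ π x∈) (λ y∈ → ∈-++⁺ʳ (π z) y∈) id-deterministic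
           (∘-deterministic exr-deterministic (split-deterministic (π z) _))
           (≈-trans identityʳ (≈-sym (exr-split (π z) _))) ⟩
    τ x ∘ wire (concatMap-⊆ π (there x∈)) ∘ id ≈⟨ refl⟩∘⟨ identityʳ ⟩
    τ x ∘ wire (concatMap-⊆ π (there x∈)) ∎

  -- Transport along equations between lists

  cast : {F : T → Obj} → ∀ {xs ys} → xs ≡ ys → ⨂ F xs ⇒ ⨂ F ys
  cast refl = id

  cast-cong-∷ : {F : T → Obj} → ∀ {x xs ys} (p : xs ≡ ys) →
                cast {F = F} (cong (x ∷_) p) ≈ id ⊗₁ cast p
  cast-cong-∷ refl = ≈-sym ⊗-id

  cast-trans : {F : T → Obj} → ∀ {xs ys zs} (p : xs ≡ ys) (q : ys ≡ zs) →
               cast {F = F} (trans p q) ≈ cast q ∘ cast p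
  cast-trans refl q = ≈-sym identityʳ

  -- Equality proofs are unique (axiom K), so a cast along any given equation can be replaced by a
  -- composite suited to an induction.
  cast-irrelevant : {F : T → Obj} → ∀ {xs ys} (p q : xs ≡ ys) → cast {F = F} p ≈ cast q
  cast-irrelevant refl refl = ≈-refl

  split-cast : {F : T → Obj} → ∀ xs {ys zs} (p : ys ≡ zs) →
    split {F = F} xs zs ∘ cast (cong (xs ++_) p) ≈ (id ⊗₁ cast p) ∘ split xs ys
  split-cast xs refl = ≈-trans identityʳ (≈-sym (≈-trans (⊗-id ⟩∘⟨ ≈-refl) identityˡ))

  cast-join : {F : T → Obj} → ∀ xs {ys zs} (p : ys ≡ zs) →
    cast (cong (xs ++_) p) ∘ join {F = F} xs ys ≈ join xs zs ∘ (id ⊗₁ cast p)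
  cast-join xs refl = ≈-trans identityˡ (≈-sym (≈-trans (refl⟩∘⟨ ⊗-id) identityʳ))

  subst₂-cast : {F : T → Obj} {G : T′ → Obj} → ∀ {xs ys zs} (p : xs ≡ xs) (q : ys ≡ zs) {f : ⨂ F xs ⇒ ⨂ G ys} →
    subst₂ (λ as bs → ⨂ F as ⇒ ⨂ G bs) p q f ≈ cast q ∘ f
  subst₂-cast refl refl = ≈-sym identityˡ

  -- Splitting, joining and flattening

  split-join : {F : T → Obj} → ∀ xs ys → split {F = F} xs ys ∘ join xs ys ≈ id
  split-join []       ys = λ-isoˡ
  split-join (x ∷ xs) ys = begin
    (α⇐ ∘ (id ⊗₁ split xs ys)) ∘ (id ⊗₁ join xs ys) ∘ α⇒ ≈⟨ assoc ⟩
    α⇐ ∘ (id ⊗₁ split xs ys) ∘ (id ⊗₁ join xs ys) ∘ α⇒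
      ≈⟨ refl⟩∘⟨ cancelˡ (≈-trans id⊗∘ (≈-trans (≈-refl ⟩⊗⟨ split-join xs ys) ⊗-id)) ⟩
    α⇐ ∘ α⇒ ≈⟨ α-isoˡ ⟩
    id ∎

  -- `alongList` splits off its first block, while `join` groups that block with the rest of its
  -- left argument. This regrouping, by pentagon, drives the induction in `alongList-join`.
  split-join-assoc : {F : T → Obj} → ∀ xs ys zs →
    split xs (ys ++ zs) ∘ cast (++-assoc xs ys zs) ∘ join {F = F} (xs ++ ys) zs ≈
    (id ⊗₁ join ys zs) ∘ α⇒ ∘ (split xs ys ⊗₁ id)
  split-join-assoc []       ys zs = begin
    λ⇐ ∘ id ∘ join ys zs                       ≈⟨ refl⟩∘⟨ identityˡ ⟩
    λ⇐ ∘ join ys zs                            ≈⟨ λ⇐-natural ⟩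
    (id ⊗₁ join ys zs) ∘ λ⇐                    ≈⟨ refl⟩∘⟨ α⇒∘λ⇐⊗id ⟨
    (id ⊗₁ join ys zs) ∘ α⇒ ∘ (λ⇐ ⊗₁ id) ∎
  split-join-assoc (x ∷ xs) ys zs = begin
    (α⇐ ∘ (id ⊗₁ split xs (ys ++ zs))) ∘ cast (cong (x ∷_) (++-assoc xs ys zs)) ∘ (id ⊗₁ join (xs ++ ys) zs) ∘ α⇒
      ≈⟨ ≈-trans assoc (refl⟩∘⟨ refl⟩∘⟨ (cast-cong-∷ (++-assoc xs ys zs) ⟩∘⟨ ≈-refl)) ⟩
    α⇐ ∘ (id ⊗₁ split xs (ys ++ zs)) ∘ (id ⊗₁ cast (++-assoc xs ys zs)) ∘ (id ⊗₁ join (xs ++ ys) zs) ∘ α⇒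
      ≈⟨ refl⟩∘⟨ ≈-trans (refl⟩∘⟨ pullˡ id⊗∘) (pullˡ id⊗∘) ⟩
    α⇐ ∘ (id ⊗₁ (split xs (ys ++ zs) ∘ cast (++-assoc xs ys zs) ∘ join (xs ++ ys) zs)) ∘ α⇒
      ≈⟨ refl⟩∘⟨ (≈-refl ⟩⊗⟨ split-join-assoc xs ys zs) ⟩∘⟨ ≈-refl ⟩
    α⇐ ∘ (id ⊗₁ ((id ⊗₁ join ys zs) ∘ α⇒ ∘ (split xs ys ⊗₁ id))) ∘ α⇒
      ≈⟨ refl⟩∘⟨ ≈-trans (≈-sym id⊗∘) (refl⟩∘⟨ ≈-sym id⊗∘) ⟩∘⟨ ≈-refl ⟩
    α⇐ ∘ ((id ⊗₁ (id ⊗₁ join ys zs)) ∘ (id ⊗₁ α⇒) ∘ (id ⊗₁ (split xs ys ⊗₁ id))) ∘ α⇒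
      ≈⟨ refl⟩∘⟨ ≈-trans assoc (refl⟩∘⟨ ≈-trans assoc (refl⟩∘⟨ ≈-sym α-natural)) ⟩
    α⇐ ∘ (id ⊗₁ (id ⊗₁ join ys zs)) ∘ (id ⊗₁ α⇒) ∘ α⇒ ∘ ((id ⊗₁ split xs ys) ⊗₁ id)
      ≈⟨ extend (≈-trans α⇐-natural ((⊗-id ⟩⊗⟨ ≈-refl) ⟩∘⟨ ≈-refl)) ⟩
    (id ⊗₁ join ys zs) ∘ α⇐ ∘ (id ⊗₁ α⇒) ∘ α⇒ ∘ ((id ⊗₁ split xs ys) ⊗₁ id)
      ≈⟨ refl⟩∘⟨ ≈-trans (refl⟩∘⟨ ≈-sym assoc) (extend pentagon-α⇐) ⟩
    (id ⊗₁ join ys zs) ∘ α⇒ ∘ (α⇐ ⊗₁ id) ∘ ((id ⊗₁ split xs ys) ⊗₁ id)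
      ≈⟨ refl⟩∘⟨ refl⟩∘⟨ ∘⊗id ⟩
    (id ⊗₁ join ys zs) ∘ α⇒ ∘ ((α⇐ ∘ (id ⊗₁ split xs ys)) ⊗₁ id) ∎

  module _ {F : T → Obj} {G : T′ → Obj} (π : T′ → List T) (τ : ∀ x → ⨂ F (π x) ⇒ G x) where
    -- Compatibility of the tensor of the `τ x` with concatenation. Leaving `eq` arbitrary lets the
    -- base case match it with `refl`.
    alongList-join : ∀ xs ys (eq : concatMap π xs ++ concatMap π ys ≡ concatMap π (xs ++ ys)) →
      alongList π τ (xs ++ ys) ∘ cast eq ∘ join (concatMap π xs) (concatMap π ys) ≈
      join xs ys ∘ (alongList π τ xs ⊗₁ alongList π τ ys)
    alongList-join []       ys refl = ≈-trans (refl⟩∘⟨ identityˡ) (≈-sym λ-natural)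
    alongList-join (x ∷ xs) ys eq   = begin
      ((τ x ⊗₁ aL (xs ++ ys)) ∘ split (π x) (π* (xs ++ ys))) ∘ cast eq ∘ join (π x ++ π* xs) (π* ys)
        -- The cast is factored into a reassociation, which `split-join-assoc` absorbs, and the
        -- tail's equation, left for the induction hypothesis.
        ≈⟨ ≈-trans assoc (refl⟩∘⟨ refl⟩∘⟨ (≈-trans (cast-irrelevant eq (trans assoc* (cong (π x ++_) eq′))) (cast-trans assoc* (cong (π x ++_) eq′))) ⟩∘⟨ ≈-refl) ⟩
      (τ x ⊗₁ aL (xs ++ ys)) ∘ split (π x) (π* (xs ++ ys)) ∘ (cast (cong (π x ++_) eq′) ∘ cast assoc*) ∘ join (π x ++ π* xs) (π* ys)
        ≈⟨ refl⟩∘⟨ ≈-trans (refl⟩∘⟨ assoc) (extend (split-cast (π x) eq′)) ⟩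
      (τ x ⊗₁ aL (xs ++ ys)) ∘ (id ⊗₁ cast eq′) ∘ split (π x) (π* xs ++ π* ys) ∘ cast assoc* ∘ join (π x ++ π* xs) (π* ys)
        ≈⟨ refl⟩∘⟨ refl⟩∘⟨ split-join-assoc (π x) (π* xs) (π* ys) ⟩
      (τ x ⊗₁ aL (xs ++ ys)) ∘ (id ⊗₁ cast eq′) ∘ (id ⊗₁ join (π* xs) (π* ys)) ∘ α⇒ ∘ (split (π x) (π* xs) ⊗₁ id)
        ≈⟨ ≈-trans (refl⟩∘⟨ pullˡ id⊗∘) (pullˡ (≈-sym ⊗-∘)) ⟩
      ((τ x ∘ id) ⊗₁ (aL (xs ++ ys) ∘ cast eq′ ∘ join (π* xs) (π* ys))) ∘ α⇒ ∘ (split (π x) (π* xs) ⊗₁ id)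
        ≈⟨ (≈-trans identityʳ (≈-sym identityˡ) ⟩⊗⟨ alongList-join xs ys eq′) ⟩∘⟨ ≈-refl ⟩
      ((id ∘ τ x) ⊗₁ (join xs ys ∘ (aL xs ⊗₁ aL ys))) ∘ α⇒ ∘ (split (π x) (π* xs) ⊗₁ id)
        ≈⟨ ≈-trans (pushˡ ⊗-∘) (refl⟩∘⟨ extend (≈-sym α-natural)) ⟩
      (id ⊗₁ join xs ys) ∘ α⇒ ∘ ((τ x ⊗₁ aL xs) ⊗₁ aL ys) ∘ (split (π x) (π* xs) ⊗₁ id)
        ≈⟨ refl⟩∘⟨ refl⟩∘⟨ ≈-trans (≈-sym ⊗-∘) (≈-refl ⟩⊗⟨ identityʳ) ⟩
      (id ⊗₁ join xs ys) ∘ α⇒ ∘ (aL (x ∷ xs) ⊗₁ aL ys)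
        ≈⟨ assoc ⟨
      ((id ⊗₁ join xs ys) ∘ α⇒) ∘ (aL (x ∷ xs) ⊗₁ aL ys) ∎
      where
      π* = concatMap π
      aL = alongList {F = F} {G} π τ
      assoc* = ++-assoc (π x) (π* xs) (π* ys)
      eq′ : π* xs ++ π* ys ≡ π* (xs ++ ys)
      eq′ = sym (concatMap-++ π xs ys)

  -- Splitting block by block gives a left inverse of `flatten`.
  flatten-monic : ∀ {F : T → Obj} (g : T′ → List T) xs {A} {h k : A ⇒ ⨂ (λ x → ⨂ F (g x)) xs} →
                  flatten g xs ∘ h ≈ flatten g xs ∘ k → h ≈ k
  flatten-monic {F = F} g xs = monic (unflatten-flatten xs)
    where
    unflatten : ∀ xs → ⨂ F (concatMap g xs) ⇒ ⨂ (λ x → ⨂ F (g x)) xs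
    unflatten []       = id
    unflatten (x ∷ xs) = (id ⊗₁ unflatten xs) ∘ split (g x) (concatMap g xs)

    unflatten-flatten : ∀ xs → unflatten xs ∘ flatten g xs ≈ id
    unflatten-flatten []       = identityˡ
    unflatten-flatten (x ∷ xs) = begin
      ((id ⊗₁ unflatten xs) ∘ split (g x) _) ∘ join (g x) (concatMap g xs) ∘ (id ⊗₁ flatten g xs) ≈⟨ assoc ⟩
      (id ⊗₁ unflatten xs) ∘ split (g x) _ ∘ join (g x) (concatMap g xs) ∘ (id ⊗₁ flatten g xs) ≈⟨ refl⟩∘⟨ cancelˡ (split-join (g x) (concatMap g xs)) ⟩
      (id ⊗₁ unflatten xs) ∘ (id ⊗₁ flatten g xs) ≈⟨ id⊗∘ ⟩
      id ⊗₁ (unflatten xs ∘ flatten g xs)         ≈⟨ ≈-trans (≈-refl ⟩⊗⟨ unflatten-flatten xs) ⊗-id ⟩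
      id ∎

-- Reordering variables under an alignment

module Alignment {o ℓ e} (C : MarkovCategory o ℓ e) {L H : FCM C} (A : VariableAlignment C L H) where
  open MarkovCategory C
  open MarkovProperties C
  open Tensor C
  open TensorProperties C
  open VariableAlignment A
  open Component using (Y)
  open AlignedComponent using (Y-unique; X-unique; x; low; high)
  private
    module L = FCM L
    module H = FCM H
    module ⇒-Reasoning {A B} = SetoidReasoning (hom {A} {B})
  open ⇒-Reasoning

  -- Both sides are deterministic, so `wire-unique` compares them component by component. Component
  -- `v` is `τ v` applied to the block of `v`, read off from `x` on either side.
  permute-τ* : ∀ {S S′} → Unique S → (πS↭ : π* S ↭ π* S′) (S↭ : S ↭ S′)
    {x : unit ⇒ ⨂ L.object (π* S)} {x′ : unit ⇒ ⨂ L.object (π* S′)} →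
    Deterministic x → Deterministic x′ → permute πS↭ ∘ x ≈ x′ →
    permute S↭ ∘ τ* S ∘ x ≈ τ* S′ ∘ x′
  permute-τ* {S} {S′} S-unique πS↭ S↭ {x} {x′} x-det x′-det eq = wire-unique
    (∈-resp-↭ (↭-sym S↭)) (∘-deterministic (τ*-det S) x-det) (∘-deterministic (τ*-det S′) x′-det)
    (λ {v} v∈ → begin
      project (∈-resp-↭ (↭-sym S↭) v∈) ∘ τ* S ∘ x
        ≈⟨ extend (project-alongList π τ (∈-resp-↭ (↭-sym S↭) v∈)) ⟩
      τ v ∘ wire (concatMap-⊆ π (∈-resp-↭ (↭-sym S↭) v∈)) ∘ x
        -- The two readings follow a priori different positions in `π* S`; they coincide because
        -- that list has no repetitions.
        ≈⟨ refl⟩∘⟨ wire-cong (concatMap-⊆ π (∈-resp-↭ (↭-sym S↭) v∈)) (λ w∈ → ∈-resp-↭ (↭-sym πS↭) (concatMap-⊆ π v∈ w∈))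
             (λ _ → unique⇒irrelevant (π*-unique S-unique) _ _) ⟩∘⟨ ≈-refl ⟩
      τ v ∘ wire (λ w∈ → ∈-resp-↭ (↭-sym πS↭) (concatMap-⊆ π v∈ w∈)) ∘ x
        ≈⟨ refl⟩∘⟨ wire-wire (concatMap-⊆ π v∈) (∈-resp-↭ (↭-sym πS↭)) x-det x′-det eq ⟨
      τ v ∘ wire (concatMap-⊆ π v∈) ∘ x′
        ≈⟨ extend (project-alongList π τ v∈) ⟨
      project v∈ ∘ τ* S′ ∘ x′ ∎)
    where
    τ*-det : ∀ S → Deterministic (τ* S)
    τ*-det = alongList-deterministic π τ τ-deterministic

  -- By disjointness, an element of the block of `v` can lie in no other block, so finding it in
  -- `π* S` betrays `v`.
  ∈-π*⁻ : ∀ {v w} S → w ∈ π v → w ∈ π* S → v ∈ S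
  ∈-π*⁻ {v} (u ∷ S) w∈v w∈ with ∈-++⁻ (π u) w∈
  ... | inj₂ w∈S = there (∈-π*⁻ S w∈v w∈S)
  ... | inj₁ w∈u with v Fin.≟ u
  ...   | yes v≡u = here v≡u
  ...   | no  v≢u = ⊥-elim (π-disjoint v≢u (w∈v , w∈u))

  module _ (π-nonempty : ∀ X → π X ≢ []) where

    -- An element `w` of the nonempty block of `v` serves as a marker for `v`. An empty block would
    -- leave no trace in `π* S`.
    π*-reflects-⊆ : ∀ {S S′} → π* S ⊆ π* S′ → S ⊆ S′
    π*-reflects-⊆ {S} {S′} πS⊆ {v} v∈ with π v in eq
    ... | []    = ⊥-elim (π-nonempty v eq)
    ... | w ∷ _ = ∈-π*⁻ S′ w∈ (πS⊆ (concatMap-⊆ π v∈ w∈))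
      where
      w∈ : w ∈ π v
      w∈ rewrite eq = here refl

    -- Lists without repetitions are permutations of each other once they have the same elements, so
    -- two inclusions suffice.
    π*-reflects-↭ : ∀ {S S′} → Unique S → Unique S′ → π* S ↭ π* S′ → S ↭ S′
    π*-reflects-↭ S-unique S′-unique πS↭ = ∼bag⇒↭ (unique∧set⇒bag S-unique S′-unique
      (mk⇔ (π*-reflects-⊆ (∈-resp-↭ πS↭)) (π*-reflects-⊆ (∈-resp-↭ (↭-sym πS↭)))))

    -- Well-definedness of `ω` on a single component. The high-level permutation is rebuilt from
    -- mere membership, which is why `permute-τ*` relates two independently given permutations.
    low-reflects-≋ : ∀ {c d : AlignedComponent C A} → _≋ᶜ_ C L (low c) (low d) → _≋ᶜ_ C H (high c) (high d)
    low-reflects-≋ {c} {d} (mk≋ᶜ Y↭ X↭ x≈) = mk≋ᶜ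
      (π*-reflects-↭ (Y-unique c) (Y-unique d) Y↭) X↭′
      (permute-τ* (X-unique c) X↭ X↭′ (SharpState.deterministic (x c)) (SharpState.deterministic (x d)) x≈)
      where
      X↭′ = π*-reflects-↭ (X-unique c) (X-unique d) X↭

  -- Flattening the outputs of a query

  outputs-low : ∀ q → concatMap Y (lowQuery C A q) ≡ π* (concatMap Y (highQuery C A q))
  outputs-low []      = refl
  outputs-low (c ∷ q) = trans (cong (π* (AlignedComponent.Y c) ++_) (outputs-low q))
                              (sym (concatMap-++ π (AlignedComponent.Y c) _))

  -- Iterates `alongList-join` over the components. `eq` is arbitrary because an abstraction
  -- supplies its own proof of `ω-outputs`.
  flatten-τ-outputs : ∀ q (eq : concatMap Y (lowQuery C A q) ≡ π* (concatMap Y (highQuery C A q))) →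
    τ* (concatMap Y (highQuery C A q)) ∘ cast eq ∘ flatten Y (lowQuery C A q) ≈
    flatten Y (highQuery C A q) ∘ τ-outputs C A q
  flatten-τ-outputs []      refl = ≈-refl ⟩∘⟨ identityˡ
  flatten-τ-outputs (c ∷ q) eq   = begin
    τ* (S ++ R) ∘ cast eq ∘ join (π* S) R′ ∘ (id ⊗₁ flatten Y (lowQuery C A q))
      -- The first factor of the cast acts on the tail only, for the induction hypothesis; the
      -- second is the one that `alongList-join` expects.
      ≈⟨ refl⟩∘⟨ ≈-trans (cast-irrelevant eq (trans (cong (π* S ++_) eq′) π*-++)) (cast-trans (cong (π* S ++_) eq′) π*-++) ⟩∘⟨ ≈-refl ⟩
    τ* (S ++ R) ∘ (cast π*-++ ∘ cast (cong (π* S ++_) eq′)) ∘ join (π* S) R′ ∘ (id ⊗₁ flatten Y (lowQuery C A q))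
      ≈⟨ refl⟩∘⟨ ≈-trans assoc (refl⟩∘⟨ extend (cast-join (π* S) eq′)) ⟩
    τ* (S ++ R) ∘ cast π*-++ ∘ join (π* S) (π* R) ∘ (id ⊗₁ cast eq′) ∘ (id ⊗₁ flatten Y (lowQuery C A q))
      ≈⟨ ≈-trans (refl⟩∘⟨ ≈-sym assoc) (≈-trans (pullˡ (alongList-join π τ S R π*-++)) assoc) ⟩
    join S R ∘ (τ* S ⊗₁ τ* R) ∘ (id ⊗₁ cast eq′) ∘ (id ⊗₁ flatten Y (lowQuery C A q))
      ≈⟨ refl⟩∘⟨ ≈-trans (refl⟩∘⟨ id⊗∘) (≈-sym ⊗-∘) ⟩
    join S R ∘ ((τ* S ∘ id) ⊗₁ (τ* R ∘ cast eq′ ∘ flatten Y (lowQuery C A q)))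
      ≈⟨ refl⟩∘⟨ (≈-trans identityʳ (≈-sym identityˡ) ⟩⊗⟨ flatten-τ-outputs q eq′) ⟩
    join S R ∘ ((id ∘ τ* S) ⊗₁ (flatten Y (highQuery C A q) ∘ τ-outputs C A q))
      ≈⟨ ≈-trans (refl⟩∘⟨ ⊗-∘) (≈-sym assoc) ⟩
    flatten Y (highQuery C A (c ∷ q)) ∘ τ-outputs C A (c ∷ q) ∎
    where
    S  = AlignedComponent.Y c
    R  = concatMap Y (highQuery C A q)
    R′ = concatMap Y (lowQuery C A q)
    π*-++ : π* S ++ π* R ≡ π* (S ++ R)
    π*-++ = sym (concatMap-++ π S R)
    eq′ : R′ ≡ π* R
    eq′ = outputs-low q

  -- The two directions of the equivalence

  module _ {p} (Q : Pred (CFQuery C H) p) where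

    -- Up to the isomorphism that flattens the outputs, naturality of ω at q is consistency at q.
    natural-square : ∀ q (inp : [] ≡ []) (out : concatMap Y (lowQuery C A q) ≡ π* (concatMap Y (highQuery C A q))) →
      τ* (concatMap Y (highQuery C A q)) ∘
        subst₂ (λ as bs → ⨂ L.object as ⇒ ⨂ L.object bs) inp out
          (flatten Y (lowQuery C A q) ∘ ⟦_⟧ C L (lowQuery C A q)) ≈
      flatten Y (highQuery C A q) ∘ τ-outputs C A q ∘ ⟦_⟧ C L (lowQuery C A q)
    natural-square q inp out = ≈-trans (refl⟩∘⟨ subst₂-cast inp out) (≈-trans (refl⟩∘⟨ ≈-sym assoc)
      (≈-trans (pullˡ (flatten-τ-outputs q out)) assoc))

    determines⇒consistent : DeterminesUpwardAbstraction C A Q → Consistent C A Q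
    determines⇒consistent abstraction q q∈Q = flatten-monic Y (highQuery C A q) (begin
      flatten Y (highQuery C A q) ∘ τ-outputs C A q ∘ ⟦_⟧ C L (lowQuery C A q)
        ≈⟨ natural-square q (ω-inputs (maps q q∈Q)) (ω-outputs (maps q q∈Q)) ⟨
      _ ≈⟨ ω-natural (maps q q∈Q) ⟩
      -- Queries have no inputs, so `τ` along the input list is the identity.
      (flatten Y (highQuery C A q) ∘ ⟦_⟧ C H (highQuery C A q)) ∘ id ≈⟨ identityʳ ⟩
      flatten Y (highQuery C A q) ∘ ⟦_⟧ C H (highQuery C A q) ∎)
      where open IsUpwardAbstraction abstraction

    -- Consistency enters only through `ω-natural`. Nonempty blocks make `ω` single-valued, and
    -- `Q-aligned` makes it reach all of `Q`.
    consistent⇒determines :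
      (∀ {q q′} → _≋ᵠ_ C H q q′ → Q q → Q q′) →
      (∀ X → π X ≢ []) →
      (∀ q → Q q → ∃[ ws ] _≋ᵠ_ C H (highQuery C A ws) q) →
      Consistent C A Q → DeterminesUpwardAbstraction C A Q
    consistent⇒determines Q-resp π-nonempty Q-aligned consistent = record
      { τ-deterministic = τ-deterministic
      ; τ-epic          = τ-epic
      ; τ-list-epic     = τ*-epic
      ; ω-functional    = λ { (maps _ _) (maps _ _) low≋ →
          Pointwise.map⁺ high high
            (Pointwise.map (low-reflects-≋ π-nonempty) (Pointwise.map⁻ low low low≋)) }
      -- The aligned query agrees with `q` only up to reordering, so its membership in `Q` is
      -- transported from `q` by `Q-resp`.
      ; ω-surjective    = λ { (q , q∈Q) → let ws , ws≋q = Q-aligned q q∈Q in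
          lowQuery C A ws ,
          (highQuery C A ws , Q-resp (IsEquivalence.sym (Pointwise.isEquivalence (≋ᶜ-isEquivalence C H)) ws≋q) q∈Q) ,
          maps ws _ , ws≋q }
      ; ω-inputs        = λ { (maps _ _) → refl }
      ; ω-outputs       = λ { (maps q _) → outputs-low q }
      ; ω-natural       = λ { (maps q q∈Q) → ≈-trans (natural-square q refl (outputs-low q))
          (≈-trans (refl⟩∘⟨ consistent q q∈Q) (≈-sym identityʳ)) }
      }

-- Closure under reordering makes `Q` a collection of queries on sets, not lists, of variables. The
-- two premises of the forward direction ensure that `ω` is a partial surjective map: an empty block
-- could be added to a set without changing its image, and a query with a sharp state not of the
-- form `τ ∘ x` would be missed.
corollary38 : ∀ {o ℓ e p : Level} (C : MarkovCategory o ℓ e) (L H : FCM C)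
    (A : VariableAlignment C L H)
    (Q : Pred (CFQuery C H) p) →
    (∀ {q q′} → _≋ᵠ_ C H q q′ → Q q → Q q′) →
    ((∀ X → VariableAlignment.π A X ≢ []) →
    (∀ q → Q q → ∃[ ws ] _≋ᵠ_ C H (highQuery C A ws) q) →
    Consistent C A Q → DeterminesUpwardAbstraction C A Q)
    × (DeterminesUpwardAbstraction C A Q → Consistent C A Q)
corollary38 C L H A Q Q-resp =
  consistent⇒determines Q Q-resp , determines⇒consistent Q
  where open Alignment C A
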